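{- For every $\varepsilon\in(0,1)$ and constant $\delta>0$, there is a polynomial-time (greedy) $\big(1/2-\varepsilon-\delta,1+\tfrac12\ln(\varepsilon^{ -1}/2)\big)$-bicriteria approximation algorithm for the problem of maximizing a non-negative symmetric submodular function subject to a knapsack constraint. In the special case of a cardinality constraint, its infeasibility ratio improves to $\lceil\tfrac12\ln(\varepsilon^{ -1}/2)\rceil$.
   Context: $f\colon2^{\mathcal N}\to\mathbb R_{\ge0}$ is submodular if $f(S\cup\{u\})-f(S)\ge f(T\cup\{u\})-f(T)$ for all $S\subseteq T\subseteq\mathcal N$, $u\notin T$; symmetric if $f(S)=f(\mathcal N\setminus S)$; accessed via a value oracle. A knapsack constraint has costs $\mathbf p\in\mathbb R^{\mathcal N}_{\ge0}$ and budget $B$ (feasible iff $\sum_{u\in S}p_u\le B$), with standing assumption $p_u\le B$ for all $u$; a cardinality constraint is the special case $\mathbf p=\mathbf 1$, $B$ integer. With $OPT$ a feasible set maximizing $f$, an $(\alpha,\beta)$-bicriteria approximation algorithm outputs $S$ with $f(S)\ge\alpha f(OPT)$ and $\sum_{u\in S}p_u\le\beta B$. -}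

module Defs where

open import Algebra.Bundles using (CommutativeRing; Semiring)
open import Algebra.Structures using (IsCommutativeRing)
import Algebra.Definitions.RawSemiring as RawSemiringOps
open import Data.Bool.Base using (Bool; true; false; not; _∧_; if_then_else_)
open import Data.Fin.Base using (Fin)
open import Data.Fin.Subset using (Subset; ⊥; ⁅_⁆; ∁; _∪_; _-_; _⊆_; _∉_)
open import Data.Integer.Base using (ℤ; +_; -[1+_])
open import Data.List.Base using (List; []; _∷_; allFin)
open import Data.Nat.Base as ℕ using (ℕ; suc)
import Data.Nat.Properties as ℕ
open import Data.Product.Base using (∃; ∃₂; _×_)
open import Data.Vec.Base as Vec using (Vec; lookup)
open import Level using (0ℓ)
open import Relation.Binary.Core using (Rel)
import Relation.Binary.Construct.NonStrictToStrict as ToStrict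
open import Relation.Binary.PropositionalEquality using (_≡_)
open import Relation.Binary.Structures using (IsDecTotalOrder)
open import Relation.Nullary using (¬_; does)

-- The value of 0# ⁻¹ is left unspecified.

record OrderedField : Set₁ where
  infix  8 _⁻¹
  infix  8 -_
  infixl 7 _*_
  infixl 6 _+_
  infixl 6 _−_
  infix  4 _≈_ _≤_

  field
    Carrier           : Set
    _≈_               : Rel Carrier 0ℓ
    _≤_               : Rel Carrier 0ℓ
    _+_ _*_           : Carrier → Carrier → Carrier
    -_ _⁻¹            : Carrier → Carrier
    0# 1#             : Carrier
    isCommutativeRing : IsCommutativeRing _≈_ _+_ _*_ -_ 0# 1#
    isDecTotalOrder   : IsDecTotalOrder _≈_ _≤_
    0≉1               : ¬ (0# ≈ 1#)
    ⁻¹-cong           : ∀ {x y} → x ≈ y → x ⁻¹ ≈ y ⁻¹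
    ⁻¹-inverseʳ       : ∀ {x} → ¬ (x ≈ 0#) → x * x ⁻¹ ≈ 1#
    +-monoʳ-≤         : ∀ x {y z} → y ≤ z → x + y ≤ x + z
    *-nonNeg          : ∀ {x y} → 0# ≤ x → 0# ≤ y → 0# ≤ x * y

  commutativeRing : CommutativeRing 0ℓ 0ℓ
  commutativeRing = record { isCommutativeRing = isCommutativeRing }

  open RawSemiringOps (Semiring.rawSemiring (CommutativeRing.semiring commutativeRing)) public
    using (_^_; sum) renaming (_×_ to _×′_)
  open IsDecTotalOrder isDecTotalOrder public using (_≤?_)
  open ToStrict _≈_ _≤_ public using (_<_)

  _−_ : Carrier → Carrier → Carrier
  x − y = x + - y

  fromℕ : ℕ → Carrier
  fromℕ n = n ×′ 1#

  fromℤ : ℤ → Carrier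
  fromℤ (+ n)    = fromℕ n
  fromℤ -[1+ n ] = - fromℕ (suc n)

  ½ : Carrier
  ½ = fromℕ 2 ⁻¹

  IsCauchy : (ℕ → Carrier) → Set
  IsCauchy s = ∀ η → 0# < η → ∃ λ N → ∀ i j → N ℕ.≤ i → N ℕ.≤ j → s i < s j + η

  ConvergesTo : (ℕ → Carrier) → Carrier → Set
  ConvergesTo s l = ∀ η → 0# < η →
    ∃ λ N → ∀ i → N ℕ.≤ i → (l − η < s i) × (s i < l + η)

  -- e = exp x, that is, e = lim (1 + x/m)^m.
  IsExp : Carrier → Carrier → Set
  IsExp x e = ConvergesTo (λ i → (1# + x * fromℕ (suc i) ⁻¹) ^ suc i) e

  -- y = ln x.
  IsLn : Carrier → Carrier → Set
  IsLn x y = IsExp y x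

  -- k = ⌈ x ⌉.
  IsCeiling : Carrier → ℤ → Set
  IsCeiling x k = (fromℤ k − 1# < x) × (x ≤ fromℤ k)

-- The real numbers, axiomatised as a Cauchy-complete Archimedean ordered field.
-- Classically these axioms determine ℝ up to a unique isomorphism.  The order
-- is decidable because the algorithms below compare real numbers exactly.

record RealField : Set₁ where
  field
    orderedField : OrderedField

  open OrderedField orderedField public

  field
    archimedean : ∀ x → ∃ λ n → x ≤ fromℕ n
    complete    : ∀ s → IsCauchy s → ∃ λ l → ConvergesTo s l

-- Programs of a real RAM with a value oracle.  Besides real registers there are
-- registers holding subsets of the ground set, which are changed one element at
-- a time.  The index k counts the element variables bound by enclosing forEach
-- loops.  A program cannot mention arbitrary real constants, only integers and
-- the parameters ε, δ and ln(ε⁻¹/2); in particular it is independent of the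
-- ground set, of the objective and of the constraint.  Time is unit cost: every
-- arithmetic operation, comparison, oracle query (value X reads f at the set in
-- register X), membership test and register update is one step.

infixr 3 _⨾_
infix  4 _≔_ _⊑_ _∈ˢ_
infixl 6 _⊕_ _⊖_
infixl 7 _⊗_

data Parameter : Set where
  epsilon delta logarithm : Parameter

data RealExpr (k : ℕ) : Set where
  literal       : ℕ → RealExpr k
  parameter     : Parameter → RealExpr k
  real          : ℕ → RealExpr k
  costOf        : Fin k → RealExpr k
  budgetB       : RealExpr k
  value         : ℕ → RealExpr k
  _⊕_ _⊖_ _⊗_   : RealExpr k → RealExpr k → RealExpr k

data Test (k : ℕ) : Set where
  _⊑_   : RealExpr k → RealExpr k → Test k
  _∈ˢ_  : Fin k → ℕ → Test k
  neg   : Test k → Test k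
  _and_ : Test k → Test k → Test k

data Command (k : ℕ) : Set where
  skip          : Command k
  _≔_           : ℕ → RealExpr k → Command k
  insert delete : Fin k → ℕ → Command k
  _⨾_           : Command k → Command k → Command k
  ifThenElse    : Test k → Command k → Command k → Command k
  while         : Test k → Command k → Command k
  forEach       : Command (suc k) → Command k

Program : Set
Program = Command 0

exprTime : ∀ {k} → RealExpr k → ℕ
exprTime (e ⊕ e′) = suc (exprTime e ℕ.+ exprTime e′)
exprTime (e ⊖ e′) = suc (exprTime e ℕ.+ exprTime e′)
exprTime (e ⊗ e′) = suc (exprTime e ℕ.+ exprTime e′)
exprTime _        = 1

testTime : ∀ {k} → Test k → ℕ
testTime (e ⊑ e′)  = suc (exprTime e ℕ.+ exprTime e′)
testTime (_ ∈ˢ _)  = 1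
testTime (neg b)   = suc (testTime b)
testTime (b and c) = suc (testTime b ℕ.+ testTime c)

IsPolynomiallyBounded : (ℕ → ℕ) → Set
IsPolynomiallyBounded T = ∃₂ λ c d → ∀ n → T n ℕ.≤ c ℕ.* suc n ℕ.^ d

module Maximization (R : RealField) where
  open RealField R

  IsSubmodular : ∀ {n} → (Subset n → Carrier) → Set
  IsSubmodular f = ∀ S T u → S ⊆ T → u ∉ T →
    f (T ∪ ⁅ u ⁆) − f T ≤ f (S ∪ ⁅ u ⁆) − f S

  IsSymmetric : ∀ {n} → (Subset n → Carrier) → Set
  IsSymmetric f = ∀ S → f S ≈ f (∁ S)

  record Instance (n : ℕ) : Set where
    field
      f             : Subset n → Carrier
      p             : Fin n → Carrier
      B             : Carrier
      f-nonNegative : ∀ S → 0# ≤ f S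
      f-symmetric   : IsSymmetric f
      f-submodular  : IsSubmodular f
      p-nonNegative : ∀ u → 0# ≤ p u
      B-nonNegative : 0# ≤ B
      p≤B           : ∀ u → p u ≤ B

    cost : Subset n → Carrier
    cost S = sum (λ u → if lookup S u then p u else 0#)

    IsFeasible : Subset n → Set
    IsFeasible S = cost S ≤ B

    IsOptimal : Subset n → Set
    IsOptimal S = IsFeasible S × (∀ T → IsFeasible T → f T ≤ f S)

    IsCardinalityConstraint : Set
    IsCardinalityConstraint = (∀ u → p u ≈ 1#) × (∃ λ b → B ≈ fromℕ b)

    IsBicriteriaApproximation : Carrier → Carrier → Subset n → Set
    IsBicriteriaApproximation α β S =
      (∀ OPT → IsOptimal OPT → α * f OPT ≤ f S) × (cost S ≤ β * B)

  record State (n : ℕ) : Set where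
    constructor ⟨_,_⟩
    field
      reals : ℕ → Carrier
      sets  : ℕ → Subset n

  open State

  infix 9 _[_↦_]
  _[_↦_] : {A : Set} → (ℕ → A) → ℕ → A → (ℕ → A)
  (r [ x ↦ a ]) y = if does (x ℕ.≟ y) then a else r y

  initial : ∀ {n} → State n
  initial = ⟨ (λ _ → 0#) , (λ _ → ⊥) ⟩

  module Semantics (par : Parameter → Carrier) {n : ℕ} (I : Instance n) where
    open Instance I using (f; p; B)

    ⟦_⟧ : ∀ {k} → RealExpr k → Vec (Fin n) k → State n → Carrier
    ⟦ literal m ⟧   ρ σ = fromℕ m
    ⟦ parameter a ⟧ ρ σ = par a
    ⟦ real x ⟧      ρ σ = reals σ x
    ⟦ costOf i ⟧    ρ σ = p (lookup ρ i)
    ⟦ budgetB ⟧     ρ σ = B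
    ⟦ value X ⟧     ρ σ = f (sets σ X)
    ⟦ e ⊕ e′ ⟧      ρ σ = ⟦ e ⟧ ρ σ + ⟦ e′ ⟧ ρ σ
    ⟦ e ⊖ e′ ⟧      ρ σ = ⟦ e ⟧ ρ σ − ⟦ e′ ⟧ ρ σ
    ⟦ e ⊗ e′ ⟧      ρ σ = ⟦ e ⟧ ρ σ * ⟦ e′ ⟧ ρ σ

    test : ∀ {k} → Test k → Vec (Fin n) k → State n → Bool
    test (e ⊑ e′)  ρ σ = does (⟦ e ⟧ ρ σ ≤? ⟦ e′ ⟧ ρ σ)
    test (i ∈ˢ X)  ρ σ = lookup (sets σ X) (lookup ρ i)
    test (neg b)   ρ σ = not (test b ρ σ)
    test (b and c) ρ σ = test b ρ σ ∧ test c ρ σ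

    -- Exec ρ c σ τ t: with the element variables bound as in ρ, command c
    -- started in state σ halts in state τ after t steps.  This is
    -- deterministic: ρ, c and σ determine τ and t.
    data Exec {k : ℕ} (ρ : Vec (Fin n) k) :
              Command k → State n → State n → ℕ → Set
    data ExecEach {k : ℕ} (ρ : Vec (Fin n) k) (c : Command (suc k)) :
                  List (Fin n) → State n → State n → ℕ → Set

    data Exec {k} ρ where
      skip        : ∀ {σ} → Exec ρ skip σ σ 1
      assign      : ∀ {x e σ} →
                    Exec ρ (x ≔ e) σ
                      ⟨ reals σ [ x ↦ ⟦ e ⟧ ρ σ ] , sets σ ⟩ (suc (exprTime e))
      insert      : ∀ {i X σ} →
                    Exec ρ (insert i X) σ
                      ⟨ reals σ , sets σ [ X ↦ sets σ X ∪ ⁅ lookup ρ i ⁆ ] ⟩ 1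
      delete      : ∀ {i X σ} →
                    Exec ρ (delete i X) σ
                      ⟨ reals σ , sets σ [ X ↦ sets σ X - lookup ρ i ] ⟩ 1
      seq         : ∀ {c c′ σ σ′ σ″ t t′} →
                    Exec ρ c σ σ′ t → Exec ρ c′ σ′ σ″ t′ →
                    Exec ρ (c ⨾ c′) σ σ″ (t ℕ.+ t′)
      if-true     : ∀ {b c c′ σ τ t} → test b ρ σ ≡ true → Exec ρ c σ τ t →
                    Exec ρ (ifThenElse b c c′) σ τ (testTime b ℕ.+ t)
      if-false    : ∀ {b c c′ σ τ t} → test b ρ σ ≡ false → Exec ρ c′ σ τ t →
                    Exec ρ (ifThenElse b c c′) σ τ (testTime b ℕ.+ t)
      while-true  : ∀ {b c σ σ′ τ t t′} → test b ρ σ ≡ true →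
                    Exec ρ c σ σ′ t → Exec ρ (while b c) σ′ τ t′ →
                    Exec ρ (while b c) σ τ (testTime b ℕ.+ t ℕ.+ t′)
      while-false : ∀ {b c σ} → test b ρ σ ≡ false →
                    Exec ρ (while b c) σ σ (testTime b)
      for-each    : ∀ {c σ τ t} → ExecEach ρ c (allFin n) σ τ t →
                    Exec ρ (forEach c) σ τ (suc t)

    data ExecEach {k} ρ c where
      []  : ∀ {σ} → ExecEach ρ c [] σ σ 0
      _∷_ : ∀ {u us σ σ′ τ t t′} →
            Exec (u Vec.∷ ρ) c σ σ′ t → ExecEach ρ c us σ′ τ t′ →
            ExecEach ρ c (u ∷ us) σ τ (suc t ℕ.+ t′)

    -- The output is the content of set register 0.
    Outputs : Program → Subset n → ℕ → Set
    Outputs A S t = ∃ λ τ → Exec Vec.[] A initial τ t × sets τ 0 ≡ S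

  parameters : (ε δ L : Carrier) → Parameter → Carrier
  parameters ε δ L epsilon   = ε
  parameters ε δ L delta     = δ
  parameters ε δ L logarithm = L

  -- On all instances in the class C, program A halts within T(n) steps and
  -- outputs an (α, β)-bicriteria approximation.
  IsBicriteriaAlgorithm : (Parameter → Carrier) → Program → (ℕ → ℕ) →
                          (∀ {n} → Instance n → Set) → Carrier → Carrier → Set
  IsBicriteriaAlgorithm par A T C α β =
    ∀ {n} (I : Instance n) → C I → ∃₂ λ S t →
      Semantics.Outputs par I A S t
      × t ℕ.≤ T n
      × Instance.IsBicriteriaApproximation I α β S

{-# OPTIONS --safe #-}
module Submission where

open import Defs
open import Data.Integer.Base using (ℤ)
open import Data.Nat.Base using (ℕ)
open import Data.Product.Base using (Σ; _×_)
open import Data.Unit.Base using (⊤)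
open import Algebra.Bundles using (CommutativeRing)
import Algebra.Properties.CommutativeSemiring.Exp as Exp
import Algebra.Properties.Ring as RingProperties
import Algebra.Properties.Semiring.Mult as Mult
import Algebra.Solver.Ring as RingSolver
open import Algebra.Solver.Ring.AlmostCommutativeRing
  using (_-Raw-AlmostCommutative⟶_; fromCommutativeRing)
open import Data.Bool.Base using (true; false; not; _∨_; if_then_else_)
open import Data.Bool.Properties using (∨-zeroʳ; ∨-identityʳ; not-involutive)
open import Data.Empty as Empty using (⊥-elim)
open import Data.Fin.Base using (Fin; zero; suc)
open import Data.Fin.Subset using (Subset; ⊥; ⁅_⁆; ∁; _∪_; _-_)
open import Data.Fin.Subset.Properties using (∪-identityˡ; ∪-identityʳ; ∪-comm; p─⊥≡p)
open import Data.Integer.Base as ℤ using (+_; -[1+_]; +[1+_]; _◃_)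
import Data.Integer.Properties as ℤ
open import Data.List.Base using (List; []; _∷_; allFin; foldl; length)
open import Data.List.Membership.Propositional using (_∈_)
open import Data.List.Membership.Propositional.Properties using (∈-allFin)
open import Data.List.Properties using (length-tabulate)
open import Data.List.Relation.Unary.Any using (here; there)
open import Data.Maybe.Base using (just; nothing)
open import Data.Nat.Base as ℕ using (zero; suc)
import Data.Nat.Properties as ℕ
open import Data.Product.Base using (∃; _,_; proj₁; proj₂)
import Data.Sign.Base as Sign
open import Data.Sum.Base using (_⊎_; inj₁; inj₂; map₂)
open import Data.Vec.Base as Vec using (Vec; []; _∷_; lookup; _[_]≔_)
open import Data.Vec.Properties
  using ( lookup-map; lookup-zipWith; lookup-replicate; lookup∘update; []=⇒lookup; lookup⇒[]=
        ; map-[]≔; []≔-idempotent; []≔-lookup )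
open import Function.Base using (id; _∘_)
import Relation.Binary.Reasoning.PartialOrder as PartialOrderReasoning
import Relation.Binary.Reasoning.Setoid as SetoidReasoning
open import Level using (0ℓ)
open import Relation.Binary.Bundles using (Poset)
open import Relation.Binary.Definitions using (WeaklyDecidable)
open import Relation.Binary.PropositionalEquality as ≡ using (_≡_)
open import Relation.Binary.Structures using (IsDecTotalOrder)
open import Relation.Nullary using (¬_; Dec; yes; no; does; ¬?; _×-dec_)

-- The algorithm is a local search interleaved with a greedy.  It maintains a
-- set S and a guess W of the optimum, starting above it.  Elements whose
-- removal increases f noticeably are removed; as long as S has not reached half
-- of the budget times L = ln (ε⁻¹/2), an element is added if its marginal value
-- per unit of cost is at least (W − 2 f S) / B; and when neither is possible, W
-- is lowered a little.
--
-- An addition multiplies W − 2 f S by at most 1 − 2 p u / B, and a removal only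
-- improves value and cost, so W − 2 f S ≤ exp (− 2 cost S / B) W throughout; at
-- cost L B / 2 this says f S ≥ (½ − ε) W.  Let O be the optimum.  If no removal
-- helps, then f (S ∖ O) ≤ f S up to the error, since deleting from S is adding
-- to its complement, and f O ≤ f (S ∪ O) + f (S ∖ O) by symmetry and
-- submodularity.  So the marginals of O over S sum to at least f O − 2 f S, and
-- W is lowered only if W ≥ f O up to the error.  Each pass over the elements
-- increases a potential that combines the size of S, f S and − W, which bounds
-- the number of passes by a quadratic polynomial in the number of elements.

-- Ordered fields

module OrderedFieldProperties (F : OrderedField) where
  open OrderedField F
  open CommutativeRing commutativeRing public
    using ( refl; sym; trans; setoid; reflexive; ring; semiring; commutativeSemiring
          ; +-cong; +-congˡ; +-congʳ; +-comm; +-identityˡ; +-identityʳ; -‿cong; -‿inverseʳ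
          ; *-cong; *-congˡ; *-congʳ; *-comm; *-assoc; *-identityˡ; *-identityʳ; zeroˡ; zeroʳ )
  open IsDecTotalOrder isDecTotalOrder public
    using (antisym; total; isPartialOrder; ≤-respˡ-≈; ≤-respʳ-≈)
    renaming (refl to ≤-refl; reflexive to ≤-reflexive; trans to ≤-trans)
  open RingProperties ring using (-‿involutive; -‿distribˡ-*; -‿distribʳ-*; -‿+-comm; -0#≈0#)
  open Mult semiring public using (×-homo-+; ×1-homo-*)
  open Exp commutativeSemiring public using (^-congˡ; ^-distrib-*)

  private
    fromℤ-⊖ : ∀ m n → fromℤ (m ℤ.⊖ n) ≈ fromℕ m − fromℕ n
    fromℤ-⊖ m zero = sym (trans (+-congˡ -0#≈0#) (+-identityʳ _))
    fromℤ-⊖ zero (suc n) = sym (+-identityˡ _)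
    fromℤ-⊖ (suc m) (suc n) rewrite ℤ.[1+m]⊖[1+n]≡m⊖n m n = trans (fromℤ-⊖ m n) (begin
      fromℕ m − fromℕ n                       ≈⟨ +-congˡ (+-identityˡ _) ⟨
      fromℕ m + (0# − fromℕ n)                ≈⟨ +-congˡ (+-congʳ (-‿inverseʳ 1#)) ⟨
      fromℕ m + ((1# − 1#) + - fromℕ n)       ≈⟨ +-congˡ (CommutativeRing.+-assoc commutativeRing _ _ _) ⟩
      fromℕ m + (1# + (- 1# + - fromℕ n))     ≈⟨ CommutativeRing.+-assoc commutativeRing _ _ _ ⟨
      (fromℕ m + 1#) + (- 1# + - fromℕ n)     ≈⟨ +-cong (+-comm _ _) (-‿+-comm _ _) ⟩
      fromℕ (suc m) − fromℕ (suc n)           ∎)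
      where open SetoidReasoning setoid

    fromℤ-neg : ∀ i → fromℤ (ℤ.- i) ≈ - fromℤ i
    fromℤ-neg (+ zero) = sym -0#≈0#
    fromℤ-neg +[1+ n ] = refl
    fromℤ-neg -[1+ n ] = sym (-‿involutive _)

    fromℤ-+ : ∀ i j → fromℤ (i ℤ.+ j) ≈ fromℤ i + fromℤ j
    fromℤ-+ (+ m) (+ n) = ×-homo-+ 1# m n
    fromℤ-+ (+ m) -[1+ n ] = fromℤ-⊖ m (suc n)
    fromℤ-+ -[1+ m ] (+ n) = trans (fromℤ-⊖ n (suc m)) (+-comm _ _)
    fromℤ-+ -[1+ m ] -[1+ n ] = trans
      (-‿cong (trans (reflexive (≡.cong fromℕ (≡.sym (ℕ.+-suc (suc m) n)))) (×-homo-+ 1# (suc m) (suc n))))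
      (sym (-‿+-comm _ _))

    fromℤ-◃⁻ : ∀ n → fromℤ (Sign.- ◃ n) ≈ - fromℕ n
    fromℤ-◃⁻ zero    = sym -0#≈0#
    fromℤ-◃⁻ (suc n) = refl

    fromℤ-◃⁺ : ∀ n → fromℤ (Sign.+ ◃ n) ≈ fromℕ n
    fromℤ-◃⁺ zero    = refl
    fromℤ-◃⁺ (suc n) = refl

    fromℤ-* : ∀ i j → fromℤ (i ℤ.* j) ≈ fromℤ i * fromℤ j
    fromℤ-* (+ m) (+ n) = trans (fromℤ-◃⁺ (m ℕ.* n)) (×1-homo-* m n)
    fromℤ-* (+ m) -[1+ n ] =
      trans (fromℤ-◃⁻ (m ℕ.* suc n)) (trans (-‿cong (×1-homo-* m (suc n))) (-‿distribʳ-* _ _))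
    fromℤ-* -[1+ m ] (+ n) =
      trans (fromℤ-◃⁻ (suc m ℕ.* n)) (trans (-‿cong (×1-homo-* (suc m) n)) (-‿distribˡ-* _ _))
    fromℤ-* -[1+ m ] -[1+ n ] = trans (×1-homo-* (suc m) (suc n))
      (trans (sym (-‿involutive _)) (trans (-‿cong (-‿distribʳ-* _ _)) (-‿distribˡ-* _ _)))

    -- Agrees with fromℤ, but maps + 1 to 1# itself rather than to 1# + 0#, so
    -- that both kinds of literals are available in the solver.
    coefficient : ℤ → Carrier
    coefficient (+ 1) = 1#
    coefficient i     = fromℤ i

    coefficient≈fromℤ : ∀ i → coefficient i ≈ fromℤ i
    coefficient≈fromℤ (+ 0)           = refl
    coefficient≈fromℤ (+ 1)           = sym (+-identityʳ 1#)
    coefficient≈fromℤ (+ suc (suc _)) = refl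
    coefficient≈fromℤ -[1+ _ ]        = refl

    morphism : CommutativeRing.rawRing ℤ.+-*-commutativeRing
               -Raw-AlmostCommutative⟶ fromCommutativeRing commutativeRing
    morphism = record
      { ⟦_⟧    = coefficient
      ; +-homo = λ i j → trans (coefficient≈fromℤ (i ℤ.+ j)) (trans (fromℤ-+ i j)
                   (sym (+-cong (coefficient≈fromℤ i) (coefficient≈fromℤ j))))
      ; *-homo = λ i j → trans (coefficient≈fromℤ (i ℤ.* j)) (trans (fromℤ-* i j)
                   (sym (*-cong (coefficient≈fromℤ i) (coefficient≈fromℤ j))))
      ; -‿homo = λ i → trans (coefficient≈fromℤ (ℤ.- i)) (trans (fromℤ-neg i)
                   (sym (-‿cong (coefficient≈fromℤ i))))
      ; 0-homo = refl
      ; 1-homo = refl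
      }

    _≟ᶜ_ : WeaklyDecidable (λ i j → coefficient i ≈ coefficient j)
    i ≟ᶜ j with i ℤ.≟ j
    ... | yes i≡j = just (reflexive (≡.cong coefficient i≡j))
    ... | no  _   = nothing

  open RingSolver (CommutativeRing.rawRing ℤ.+-*-commutativeRing)
    (fromCommutativeRing commutativeRing) morphism _≟ᶜ_ public
    using (solve; _:=_; _:+_; _:*_; _:-_; :-_; con)

  poset : Poset 0ℓ 0ℓ 0ℓ
  poset = record { isPartialOrder = isPartialOrder }

  ≤⇒0≤− : ∀ {x y} → x ≤ y → 0# ≤ y − x
  ≤⇒0≤− {x} {y} x≤y = ≤-respʳ-≈ (+-comm (- x) y)
    (≤-respˡ-≈ (trans (+-comm _ _) (-‿inverseʳ x)) (+-monoʳ-≤ (- x) x≤y))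

  -- Inequalities are proved by exhibiting the difference of the two sides as a
  -- nonnegative combination of such; the identity is left to the ring solver.
  ≤-by : ∀ {x y d} → 0# ≤ d → y − x ≈ d → x ≤ y
  ≤-by {x} {y} {d} 0≤d eq = ≤-respˡ-≈ (+-identityʳ x)
    (≤-respʳ-≈ (solve 2 (λ x y → x :+ (y :- x) := y) refl x y)
      (+-monoʳ-≤ x (≤-respʳ-≈ (sym eq) 0≤d)))

  infixl 6 _⊕⁰_
  infixl 7 _⊗⁰_

  _⊕⁰_ : ∀ {x y} → 0# ≤ x → 0# ≤ y → 0# ≤ x + y
  _⊕⁰_ {x} {y} 0≤x 0≤y = ≤-trans (≤-respʳ-≈ (sym (+-identityʳ x)) 0≤x) (+-monoʳ-≤ x 0≤y)

  _⊗⁰_ : ∀ {x y} → 0# ≤ x → 0# ≤ y → 0# ≤ x * y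
  _⊗⁰_ = *-nonNeg

  ≈⇒0≤− : ∀ {x y} → x ≈ y → 0# ≤ y − x
  ≈⇒0≤− eq = ≤⇒0≤− (≤-reflexive eq)

  ≰⇒≥ : ∀ {x y} → ¬ (x ≤ y) → y ≤ x
  ≰⇒≥ {x} {y} x≰y with total x y
  ... | inj₁ x≤y = ⊥-elim (x≰y x≤y)
  ... | inj₂ y≤x = y≤x

  ≰⇒> : ∀ {x y} → ¬ (x ≤ y) → y < x
  ≰⇒> x≰y = ≰⇒≥ x≰y , λ y≈x → x≰y (≤-reflexive (sym y≈x))

  <⇒≱ : ∀ {x y} → x < y → ¬ (y ≤ x)
  <⇒≱ (x≤y , x≉y) y≤x = x≉y (antisym x≤y y≤x)

  square-nonNeg : ∀ x → 0# ≤ x * x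
  square-nonNeg x with total 0# x
  ... | inj₁ 0≤x = 0≤x ⊗⁰ 0≤x
  ... | inj₂ x≤0 = ≤-respʳ-≈ (solve 1 (λ x → (con (+ 0) :- x) :* (con (+ 0) :- x) := x :* x) refl x)
                     (≤⇒0≤− x≤0 ⊗⁰ ≤⇒0≤− x≤0)

  0≤1 : 0# ≤ 1#
  0≤1 = ≤-respʳ-≈ (*-identityʳ 1#) (square-nonNeg 1#)

  1≰0 : ¬ (1# ≤ 0#)
  1≰0 1≤0 = 0≉1 (antisym 0≤1 1≤0)

  fromℕ-nonNeg : ∀ n → 0# ≤ fromℕ n
  fromℕ-nonNeg zero    = ≤-refl
  fromℕ-nonNeg (suc n) = 0≤1 ⊕⁰ fromℕ-nonNeg n

  fromℕ-suc-pos : ∀ n → 0# < fromℕ (suc n)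
  fromℕ-suc-pos n = ≰⇒> λ le → 1≰0 (≤-trans
    (≤-by (fromℕ-nonNeg n) (solve 1 (λ x → (con (+ 1) :+ x) :- con (+ 1) := x) refl (fromℕ n))) le)

  fromℕ-mono : ∀ {m n} → m ℕ.≤ n → fromℕ m ≤ fromℕ n
  fromℕ-mono {n = n} ℕ.z≤n = fromℕ-nonNeg n
  fromℕ-mono (ℕ.s≤s m≤n)   = +-monoʳ-≤ 1# (fromℕ-mono m≤n)

  fromℕ-cancel-< : ∀ {m n} → ¬ (fromℕ n ≤ fromℕ m) → m ℕ.< n
  fromℕ-cancel-< {m} {n} n≰m with n ℕ.≤? m
  ... | yes n≤m = ⊥-elim (n≰m (fromℕ-mono n≤m))
  ... | no ¬n≤m = ℕ.≰⇒> ¬n≤m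

  ⁻¹-inverse : ∀ {x} → 0# < x → x * x ⁻¹ ≈ 1#
  ⁻¹-inverse (_ , 0≉x) = ⁻¹-inverseʳ λ x≈0 → 0≉x (sym x≈0)

  ⁻¹-nonNeg : ∀ {x} → 0# < x → 0# ≤ x ⁻¹
  ⁻¹-nonNeg {x} 0<x with total 0# (x ⁻¹)
  ... | inj₁ 0≤x⁻¹ = 0≤x⁻¹
  ... | inj₂ x⁻¹≤0 = ⊥-elim (1≰0 (≤-by (proj₁ 0<x ⊗⁰ ≤⇒0≤− x⁻¹≤0)
    (trans (+-congˡ (-‿cong (sym (⁻¹-inverse 0<x))))
      (solve 2 (λ x i → con (+ 0) :- x :* i := x :* (con (+ 0) :- i)) refl x (x ⁻¹)))))

  *-cancel-≤ : ∀ {x y z} → 0# < z → z * x ≤ z * y → x ≤ y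
  *-cancel-≤ {x} {y} {z} 0<z zx≤zy = ≤-by (⁻¹-nonNeg 0<z ⊗⁰ ≤⇒0≤− zx≤zy) (begin
    y − x                    ≈⟨ *-identityˡ _ ⟨
    1# * (y − x)             ≈⟨ *-congʳ (⁻¹-inverse 0<z) ⟨
    z * z ⁻¹ * (y − x)       ≈⟨ solve 4 (λ x y z i → z :* i :* (y :- x) := i :* (z :* y :- z :* x)) refl x y z (z ⁻¹) ⟩
    z ⁻¹ * (z * y − z * x)   ∎)
    where open SetoidReasoning setoid

  *-monoʳ-≤ : ∀ {x y z} → 0# ≤ z → x ≤ y → z * x ≤ z * y
  *-monoʳ-≤ {x} {y} {z} 0≤z x≤y = ≤-by (0≤z ⊗⁰ ≤⇒0≤− x≤y)
    (solve 3 (λ x y z → z :* y :- z :* x := z :* (y :- x)) refl x y z)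

  *-monoˡ-≤ : ∀ {x y z} → 0# ≤ z → x ≤ y → x * z ≤ y * z
  *-monoˡ-≤ {x} {y} {z} 0≤z x≤y = ≤-by (≤⇒0≤− x≤y ⊗⁰ 0≤z)
    (solve 3 (λ x y z → y :* z :- x :* z := (y :- x) :* z) refl x y z)

  ½-double : fromℕ 2 * ½ ≈ 1#
  ½-double = ⁻¹-inverse (fromℕ-suc-pos 1)

  ^-nonNeg : ∀ {x} n → 0# ≤ x → 0# ≤ x ^ n
  ^-nonNeg zero    _   = 0≤1
  ^-nonNeg (suc n) 0≤x = 0≤x ⊗⁰ ^-nonNeg n 0≤x

  ^-mono : ∀ {x y} n → 0# ≤ x → x ≤ y → x ^ n ≤ y ^ n
  ^-mono zero    _   _   = ≤-refl
  ^-mono (suc n) 0≤x x≤y = ≤-trans (*-monoʳ-≤ 0≤x (^-mono n 0≤x x≤y))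
    (*-monoˡ-≤ (^-nonNeg n (≤-trans 0≤x x≤y)) x≤y)

  1^ : ∀ n → 1# ^ n ≈ 1#
  1^ zero    = refl
  1^ (suc n) = trans (*-identityˡ _) (1^ n)

  -- The induction step multiplies by 1 + x, and (1 + x)(1 + n x) exceeds 1 + (n + 1) x by n x².
  bernoulli : ∀ {x} n → 0# ≤ 1# + x → 1# + fromℕ n * x ≤ (1# + x) ^ n
  bernoulli {x} zero    _ = ≤-reflexive (solve 1 (λ x → con (+ 1) :+ con (+ 0) :* x := con (+ 1)) refl x)
  bernoulli {x} (suc n) 0≤1+x = ≤-trans
    (≤-by (fromℕ-nonNeg n ⊗⁰ square-nonNeg x)
      (solve 2 (λ x n → (con (+ 1) :+ x) :* (con (+ 1) :+ n :* x) :- (con (+ 1) :+ (con (+ 1) :+ n) :* x)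
                        := n :* (x :* x)) refl x (fromℕ n)))
    (*-monoʳ-≤ 0≤1+x (bernoulli n 0≤1+x))

  -- The exponential through its finite approximations

  expStep : Carrier → ℕ → Carrier
  expStep x i = 1# + x * fromℕ (suc i) ⁻¹

  -- The i-th term of the sequence whose limit is exp x.
  expApprox : Carrier → ℕ → Carrier
  expApprox x i = expStep x i ^ suc i

  module _ (i : ℕ) where
    private
      m⁻¹ = fromℕ (suc i) ⁻¹

      m⁻¹-nonNeg : 0# ≤ m⁻¹
      m⁻¹-nonNeg = ⁻¹-nonNeg (fromℕ-suc-pos i)

      m*m⁻¹ : fromℕ (suc i) * m⁻¹ ≈ 1#
      m*m⁻¹ = ⁻¹-inverse (fromℕ-suc-pos i)

    -- For negative x the base 1 + x / m becomes nonnegative once m ≥ - x; monotonicity of its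
    -- powers is available only from there on.
    expStep-nonNeg : ∀ {x} → - fromℕ (suc i) ≤ x → 0# ≤ expStep x i
    expStep-nonNeg {x} -m≤x = ≤-respʳ-≈ (begin
      (x − - fromℕ (suc i)) * m⁻¹   ≈⟨ solve 3 (λ x m j → (x :- (:- m)) :* j := m :* j :+ x :* j) refl x _ _ ⟩
      fromℕ (suc i) * m⁻¹ + x * m⁻¹ ≈⟨ +-congʳ m*m⁻¹ ⟩
      expStep x i                   ∎) (≤⇒0≤− -m≤x ⊗⁰ m⁻¹-nonNeg)
      where open SetoidReasoning setoid

    expStep-mono : ∀ {x y} → x ≤ y → expStep x i ≤ expStep y i
    expStep-mono x≤y = +-monoʳ-≤ 1# (*-monoˡ-≤ m⁻¹-nonNeg x≤y)

    nonNeg⇒expStep-nonNeg : ∀ {x} → 0# ≤ x → 0# ≤ expStep x i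
    nonNeg⇒expStep-nonNeg 0≤x = 0≤1 ⊕⁰ (0≤x ⊗⁰ m⁻¹-nonNeg)

    expApprox-mono : ∀ {x y} → 0# ≤ expStep x i → x ≤ y → expApprox x i ≤ expApprox y i
    expApprox-mono 0≤x x≤y = ^-mono (suc i) 0≤x (expStep-mono x≤y)

    bernoulli-exp : ∀ {x} → 0# ≤ expStep x i → 1# + x ≤ expApprox x i
    bernoulli-exp {x} 0≤x = ≤-trans (≤-reflexive (+-congˡ (begin
      x                             ≈⟨ *-identityˡ x ⟨
      1# * x                        ≈⟨ *-congʳ m*m⁻¹ ⟨
      fromℕ (suc i) * m⁻¹ * x       ≈⟨ solve 3 (λ m j x → m :* j :* x := m :* (x :* j)) refl _ _ _ ⟩
      fromℕ (suc i) * (x * m⁻¹)     ∎))) (bernoulli (suc i) 0≤x)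
      where open SetoidReasoning setoid

    1≤expApprox : ∀ {x} → 0# ≤ x → 1# ≤ expApprox x i
    1≤expApprox {x} 0≤x = ≤-trans
      (≤-by 0≤x (solve 1 (λ x → (con (+ 1) :+ x) :- con (+ 1) := x) refl x))
      (bernoulli-exp (nonNeg⇒expStep-nonNeg 0≤x))

    -- Per factor, (1 + x/m)(1 + y/m) exceeds 1 + (x + y)/m by the cross term. Before the limit only
    -- this half of the functional equation is available.
    expApprox-+ : ∀ {x y} → 0# ≤ x → 0# ≤ y → expApprox (x + y) i ≤ expApprox x i * expApprox y i
    expApprox-+ {x} {y} 0≤x 0≤y = ≤-trans
      (^-mono (suc i) (nonNeg⇒expStep-nonNeg (0≤x ⊕⁰ 0≤y))
        (≤-by (0≤x ⊗⁰ m⁻¹-nonNeg ⊗⁰ (0≤y ⊗⁰ m⁻¹-nonNeg))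
          (solve 3 (λ x y j → (con (+ 1) :+ x :* j) :* (con (+ 1) :+ y :* j)
                              :- (con (+ 1) :+ (x :+ y) :* j)
                              := x :* j :* (y :* j)) refl x y m⁻¹)))
      (≤-reflexive (^-distrib-* _ _ (suc i)))

    -- Corresponding factors multiply to 1 - (y/m)², which is at most 1.
    expApprox-inverse : ∀ {y} → 0# ≤ expStep y i → 0# ≤ expStep (- y) i →
                        expApprox y i * expApprox (- y) i ≤ 1#
    expApprox-inverse {y} 0≤y 0≤-y = ≤-trans (≤-reflexive (sym (^-distrib-* _ _ (suc i))))
      (≤-trans (^-mono (suc i) (0≤y ⊗⁰ 0≤-y)
        (≤-by (square-nonNeg (y * m⁻¹)) (solve 2 (λ y j → con (+ 1) :- (con (+ 1) :+ y :* j) :* (con (+ 1) :+ (:- y) :* j)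
                                      := (y :* j) :* (y :* j)) refl y m⁻¹)))
        (≤-reflexive (1^ (suc i))))

    -- A finite form of 1 - y ≤ exp (- y). For y ≤ 1, Bernoulli bounds 1 - y by the approximation at
    -- - y, and the two approximations multiply to at most 1; for y ≥ 1 the left side is not
    -- positive.
    expApprox-decay : ∀ {y} → 0# ≤ y → expApprox y i * (1# − y) ≤ 1#
    expApprox-decay {y} 0≤y with total y 1#
    ... | inj₁ y≤1 = ≤-trans (*-monoʳ-≤ (^-nonNeg (suc i) E) (bernoulli-exp E⁻)) (expApprox-inverse E E⁻)
      where
      E  = nonNeg⇒expStep-nonNeg 0≤y
      E⁻ = expStep-nonNeg { - y} (≤-by (≤⇒0≤− y≤1 ⊕⁰ fromℕ-nonNeg i)
        (solve 2 (λ y m → :- y :- (:- (con (+ 1) :+ m)) := (con (+ 1) :- y) :+ m) refl y (fromℕ i)))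
    ... | inj₂ 1≤y = ≤-trans
      (≤-by (^-nonNeg (suc i) (nonNeg⇒expStep-nonNeg 0≤y) ⊗⁰ ≤⇒0≤− 1≤y)
        (solve 2 (λ e y → con (+ 0) :- e :* (con (+ 1) :- y) := e :* (y :- con (+ 1))) refl _ y))
      0≤1

-- Subsets, limits and submodular functions

∪⁅⁆-≡ : ∀ {n} (S : Subset n) u → S ∪ ⁅ u ⁆ ≡ S [ u ]≔ true
∪⁅⁆-≡ (b ∷ S) zero    = ≡.cong₂ _∷_ (∨-zeroʳ b) (∪-identityʳ S)
∪⁅⁆-≡ (b ∷ S) (suc u) = ≡.cong₂ _∷_ (∨-identityʳ b) (∪⁅⁆-≡ S u)

-⁅⁆-≡ : ∀ {n} (S : Subset n) u → S - u ≡ S [ u ]≔ false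
-⁅⁆-≡ (b ∷ S) zero    = ≡.cong (false ∷_) (p─⊥≡p S)
-⁅⁆-≡ (b ∷ S) (suc u) = ≡.cong (b ∷_) (-⁅⁆-≡ S u)

∪-[]≔ : ∀ {n} (S X : Subset n) u → S ∪ (X [ u ]≔ true) ≡ (S ∪ X) [ u ]≔ true
∪-[]≔ (b ∷ S) (x ∷ X) zero    = ≡.cong (_∷ S ∪ X) (∨-zeroʳ b)
∪-[]≔ (b ∷ S) (x ∷ X) (suc u) = ≡.cong ((b ∨ x) ∷_) (∪-[]≔ S X u)

[]≔-unchanged : ∀ {n} (S : Subset n) u {b} → lookup S u ≡ b → S [ u ]≔ b ≡ S
[]≔-unchanged S u ≡.refl = []≔-lookup S u

[]≔-restore : ∀ {n} (S : Subset n) u {b c} → lookup S u ≡ b → (S [ u ]≔ c) [ u ]≔ b ≡ S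
[]≔-restore S u S[u]≡b = ≡.trans ([]≔-idempotent S u) ([]≔-unchanged S u S[u]≡b)

[]≔-true-⊇ : ∀ {n} (X : Subset n) u v → lookup X v ≡ true → lookup (X [ u ]≔ true) v ≡ true
[]≔-true-⊇ (_ ∷ _) zero    zero    _   = ≡.refl
[]≔-true-⊇ (_ ∷ _) zero    (suc v) X∋v = X∋v
[]≔-true-⊇ (_ ∷ _) (suc u) zero    X∋v = X∋v
[]≔-true-⊇ (_ ∷ X) (suc u) (suc v) X∋v = []≔-true-⊇ X u v X∋v

∪-⊇ˡ : ∀ {n} (S X : Subset n) v → lookup S v ≡ true → lookup (S ∪ X) v ≡ true
∪-⊇ˡ S X v S∋v rewrite lookup-zipWith _∨_ v S X | S∋v = ≡.refl

∪-∌ˡ : ∀ {n} (S X : Subset n) v → lookup (S ∪ X) v ≡ false → lookup S v ≡ false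
∪-∌ˡ S X v S∪X∌v with lookup S v in eq
... | false = ≡.refl
... | true  = ≡.trans (≡.sym (∪-⊇ˡ S X v eq)) S∪X∌v

∪-∋ˡ : ∀ {n} (S X : Subset n) v → lookup X v ≡ false → lookup (S ∪ X) v ≡ true → lookup S v ≡ true
∪-∋ˡ S X v X∌v S∪X∋v rewrite lookup-zipWith _∨_ v S X | X∌v = ≡.trans (≡.sym (∨-identityʳ _)) S∪X∋v

∪-monoˡ : ∀ {n} (S T X : Subset n) → (∀ v → lookup S v ≡ true → lookup T v ≡ true) →
          ∀ v → lookup (S ∪ X) v ≡ true → lookup (T ∪ X) v ≡ true
∪-monoˡ S T X S⊆T v h rewrite lookup-zipWith _∨_ v S X | lookup-zipWith _∨_ v T X
  with lookup S v | S⊆T v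
... | true  | T∋v rewrite T∋v ≡.refl = ≡.refl
... | false | _   rewrite h = ∨-zeroʳ _

-- The step is restricted to elements outside `X`, so that `weight-insert` applies to each of them.
subset-induction : ∀ {n} (P : Subset n → Set) → P ⊥ →
  (∀ X u → lookup X u ≡ false → P X → P (X [ u ]≔ true)) → ∀ X → P X
subset-induction P base step [] = base
subset-induction P base step (b ∷ X) = extend b
  (subset-induction (P ∘ (false ∷_)) base (λ Y u → step (false ∷ Y) (suc u)) X)
  where
  extend : ∀ b → P (false ∷ X) → P (b ∷ X)
  extend false h = h
  extend true  h = step (false ∷ X) zero ≡.refl h

-- Limits, logarithms and weights of subsets

module RealFieldProperties (R : RealField) where
  open RealField R
  open OrderedFieldProperties orderedField public
  open Maximization R

  limit-≤ : ∀ {s l b} N → ConvergesTo s l → (∀ i → N ℕ.≤ i → s i ≤ b) → l ≤ b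
  limit-≤ {s} {l} {b} N s→l s≤b with l ≤? b
  ... | yes l≤b = l≤b
  ... | no  l≰b = ⊥-elim (<⇒≱ b<si (s≤b i (ℕ.m≤m⊔n N M)))
    where
    η   = l − b
    0<η : 0# < η
    0<η = ≰⇒> λ η≤0 → l≰b (≤-by (≤⇒0≤− η≤0)
      (solve 2 (λ l b → b :- l := con (+ 0) :- (l :- b)) refl l b))
    M   = proj₁ (s→l η 0<η)
    i   = N ℕ.⊔ M
    l−η<si = proj₁ (proj₂ (s→l η 0<η) i (ℕ.m≤n⊔m N M))
    l−η≈b : l − η ≈ b
    l−η≈b = solve 2 (λ l b → l :- (l :- b) := b) refl l b
    b<si : b < s i
    b<si = ≤-respˡ-≈ l−η≈b (proj₁ l−η<si) , λ b≈si → proj₂ l−η<si (trans l−η≈b b≈si)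

  -- For a > 0 the factor is divided out before passing to the limit; for a = 0 the bound at the
  -- single index `N` already gives 0 ≤ b.
  limit-*-≤ : ∀ {s l a b} N → ConvergesTo s l → 0# ≤ a →
              (∀ i → N ℕ.≤ i → s i * a ≤ b) → l * a ≤ b
  limit-*-≤ {s} {l} {a} {b} N s→l 0≤a sa≤b with a ≤? 0#
  ... | yes a≤0 = ≤-trans (≤-reflexive (trans (a*-zero l) (sym (a*-zero (s N))))) (sa≤b N ℕ.≤-refl)
    where
    a*-zero : ∀ x → x * a ≈ 0#
    a*-zero x = trans (*-congˡ (antisym a≤0 0≤a)) (zeroʳ x)
  ... | no a≰0 = ≤-trans (*-monoˡ-≤ 0≤a (limit-≤ N s→l bound)) (≤-reflexive (begin
      b * a ⁻¹ * a     ≈⟨ *-assoc b _ _ ⟩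
      b * (a ⁻¹ * a)   ≈⟨ *-congˡ (*-comm _ a) ⟩
      b * (a * a ⁻¹)   ≈⟨ *-congˡ (⁻¹-inverse 0<a) ⟩
      b * 1#           ≈⟨ *-identityʳ b ⟩
      b                ∎))
    where
    open SetoidReasoning setoid
    0<a = ≰⇒> a≰0
    bound : ∀ i → N ℕ.≤ i → s i ≤ b * a ⁻¹
    bound i N≤i = *-cancel-≤ 0<a (≤-trans (≤-reflexive (*-comm a _)) (≤-trans (sa≤b i N≤i)
      (≤-reflexive (trans (sym (*-identityʳ b)) (trans (*-congˡ (sym (⁻¹-inverse 0<a)))
        (solve 3 (λ a b j → b :* (a :* j) := a :* (b :* j)) refl a b (a ⁻¹)))))))

  double-half-inverse : ∀ {ε} → 0# < ε → fromℕ 2 * ε * (ε ⁻¹ * ½) ≈ 1#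
  double-half-inverse {ε} 0<ε = begin
    fromℕ 2 * ε * (ε ⁻¹ * ½)    ≈⟨ solve 4 (λ t e j h → t :* e :* (j :* h) := e :* j :* (t :* h)) refl _ ε _ ½ ⟩
    ε * ε ⁻¹ * (fromℕ 2 * ½)    ≈⟨ *-cong (⁻¹-inverse 0<ε) ½-double ⟩
    1# * 1#                     ≈⟨ *-identityʳ 1# ⟩
    1#                          ∎
    where open SetoidReasoning setoid

  -- If L < - 1, then exp L ≤ exp (- 1) ≤ ½, because exp 1 ≥ 2 by Bernoulli, and exp L = 1 / (2ε)
  -- would force ε ≥ 1. The bound keeps both infeasibility ratios nonnegative when ε > ½ makes `L`
  -- negative.
  -1≤ln : ∀ {ε L} → 0# < ε → ε < 1# → IsLn (ε ⁻¹ * ½) L → - 1# ≤ L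
  -1≤ln {ε} {L} 0<ε ε<1 isLn with - 1# ≤? L
  ... | yes -1≤L = -1≤L
  ... | no  -1≰L = ⊥-elim (<⇒≱ ε<1 1≤ε)
    where
    N    = proj₁ (archimedean (- L))
    -L≤N = proj₂ (archimedean (- L))

    bound : ∀ i → N ℕ.≤ i → expApprox L i * fromℕ 2 ≤ 1#
    bound i N≤i = ≤-trans (*-monoˡ-≤ (fromℕ-nonNeg 2) (expApprox-mono i (expStep-nonNeg i -m≤L) (≰⇒≥ -1≰L)))
      (≤-trans (≤-trans (*-monoʳ-≤ (^-nonNeg (suc i) 0≤E⁻)
          (≤-trans (≤-reflexive (solve 0 (con (+ 2) := con (+ 1) :+ con (+ 1)) refl)) (bernoulli-exp i 0≤E)))
        (≤-reflexive (*-comm _ _))) (expApprox-inverse i 0≤E 0≤E⁻))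
      where
      0≤E = nonNeg⇒expStep-nonNeg i 0≤1
      0≤E⁻ = expStep-nonNeg i (≤-by (fromℕ-nonNeg i)
        (solve 1 (λ i → :- con (+ 1) :- (:- (con (+ 1) :+ i)) := i) refl (fromℕ i)))
      -m≤L : - fromℕ (suc i) ≤ L
      -m≤L = ≤-by (≤⇒0≤− (≤-trans -L≤N (fromℕ-mono (ℕ.m≤n⇒m≤1+n N≤i))))
        (solve 2 (λ l m → l :- (:- m) := m :- (:- l)) refl L (fromℕ (suc i)))

    1≤ε : 1# ≤ ε
    1≤ε = ≤-trans (≤-reflexive (trans (sym (double-half-inverse 0<ε))
        (solve 3 (λ t e x → t :* e :* x := e :* (x :* t)) refl (fromℕ 2) ε _)))
      (≤-trans (*-monoʳ-≤ (proj₁ 0<ε) (limit-*-≤ N isLn (fromℕ-nonNeg 2) bound))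
        (≤-reflexive (*-identityʳ ε)))

  -- In the limit exp x is at least exp L = 1 / (2ε), so a / (2ε) ≤ b. Assuming the bound at every
  -- finite stage avoids constructing exp x itself.
  exp-ln-≤ : ∀ {ε L x a b} → 0# < ε → IsLn (ε ⁻¹ * ½) L → L ≤ x → 0# ≤ a →
             (∀ i → expApprox x i * a ≤ b) → a ≤ fromℕ 2 * ε * b
  exp-ln-≤ {ε} {L} {x} {a} {b} 0<ε isLn L≤x 0≤a xa≤b =
    ≤-trans (≤-reflexive (trans (sym (*-identityˡ a)) (trans (*-congʳ (sym (double-half-inverse 0<ε)))
        (*-assoc _ _ a))))
      (*-monoʳ-≤ (fromℕ-nonNeg 2 ⊗⁰ proj₁ 0<ε)
        (limit-*-≤ N isLn 0≤a λ i N≤i → ≤-trans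
          (*-monoˡ-≤ 0≤a (expApprox-mono i (expStep-nonNeg i (-m≤L i N≤i)) L≤x)) (xa≤b i)))
    where
    N    = proj₁ (archimedean (- L))
    -L≤N = proj₂ (archimedean (- L))
    -m≤L : ∀ i → N ℕ.≤ i → - fromℕ (suc i) ≤ L
    -m≤L i N≤i = ≤-by (≤⇒0≤− (≤-trans -L≤N (fromℕ-mono (ℕ.m≤n⇒m≤1+n N≤i))))
      (solve 2 (λ l m → l :- (:- m) := m :- (:- l)) refl L (fromℕ (suc i)))

  -- Exhaustive search over both choices for the first element. It supplies an optimum for the
  -- analysis to compare with; the program never runs it.
  subset-argmax : ∀ {n} (g : Subset n → Carrier) {P : Subset n → Set} → (∀ S → Dec (P S)) →
    (∃ λ S → P S × (∀ T → P T → g T ≤ g S)) ⊎ (∀ S → ¬ P S)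
  subset-argmax {zero} g P? with P? []
  ... | yes p = inj₁ ([] , p , λ { [] _ → ≤-refl })
  ... | no ¬p = inj₂ λ { [] → ¬p }
  subset-argmax {suc n} g P? with subset-argmax (g ∘ (true ∷_)) (P? ∘ (true ∷_))
                                | subset-argmax (g ∘ (false ∷_)) (P? ∘ (false ∷_))
  ... | inj₂ none | inj₂ none′ = inj₂ λ { (true ∷ S) → none S ; (false ∷ S) → none′ S }
  ... | inj₁ (S , p , max) | inj₂ none = inj₁ (true ∷ S , p ,
    λ { (true ∷ T) → max T ; (false ∷ T) q → ⊥-elim (none T q) })
  ... | inj₂ none | inj₁ (S , p , max) = inj₁ (false ∷ S , p ,
    λ { (false ∷ T) → max T ; (true ∷ T) q → ⊥-elim (none T q) })
  ... | inj₁ (S , p , max) | inj₁ (S′ , p′ , max′) with total (g (true ∷ S)) (g (false ∷ S′))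
  ...   | inj₁ le = inj₁ (false ∷ S′ , p′ ,
    λ { (true ∷ T) q → ≤-trans (max T q) le ; (false ∷ T) → max′ T })
  ...   | inj₂ ge = inj₁ (true ∷ S , p ,
    λ { (true ∷ T) → max T ; (false ∷ T) q → ≤-trans (max′ T q) ge })

  weight : ∀ {n} → (Fin n → Carrier) → Subset n → Carrier
  weight w S = sum (λ u → if lookup S u then w u else 0#)

  weight-insert : ∀ {n} (w : Fin n → Carrier) S u → lookup S u ≡ false →
                  weight w (S [ u ]≔ true) ≈ weight w S + w u
  weight-insert w (false ∷ S) zero _ =
    solve 2 (λ a s → a :+ s := con (+ 0) :+ s :+ a) refl (w zero) _
  weight-insert w (b ∷ S) (suc u) S∌u = trans (+-congˡ (weight-insert (w ∘ suc) S u S∌u))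
    (sym (CommutativeRing.+-assoc commutativeRing _ _ _))

  weight-remove : ∀ {n} (w : Fin n → Carrier) S u → lookup S u ≡ true →
                  weight w S ≈ weight w (S [ u ]≔ false) + w u
  weight-remove w S u S∋u = trans (reflexive (≡.cong (weight w) (≡.sym ([]≔-restore S u S∋u))))
    (weight-insert w (S [ u ]≔ false) u (lookup∘update u S false))

  weight-⊥ : ∀ {n} (w : Fin n → Carrier) → weight w ⊥ ≈ 0#
  weight-⊥ {zero}  w = refl
  weight-⊥ {suc n} w = trans (+-identityˡ _) (weight-⊥ (w ∘ suc))

  weight-nonNeg : ∀ {n} {w : Fin n → Carrier} → (∀ u → 0# ≤ w u) → ∀ S → 0# ≤ weight w S
  weight-nonNeg 0≤w []          = ≤-refl
  weight-nonNeg 0≤w (true ∷ S)  = 0≤w zero ⊕⁰ weight-nonNeg (0≤w ∘ suc) S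
  weight-nonNeg 0≤w (false ∷ S) = ≤-refl ⊕⁰ weight-nonNeg (0≤w ∘ suc) S

  weight-const-≤ : ∀ {n c} → 0# ≤ c → (S : Subset n) → weight (λ _ → c) S ≤ fromℕ n * c
  weight-const-≤ {c = c} 0≤c [] = ≤-reflexive (sym (zeroˡ c))
  weight-const-≤ {suc n} {c} 0≤c (true ∷ S) = ≤-by (≤⇒0≤− (weight-const-≤ 0≤c S))
    (solve 3 (λ n c s → (con (+ 1) :+ n) :* c :- (c :+ s) := n :* c :- s) refl (fromℕ n) c _)
  weight-const-≤ {suc n} {c} 0≤c (false ∷ S) = ≤-by (0≤c ⊕⁰ ≤⇒0≤− (weight-const-≤ 0≤c S))
    (solve 3 (λ n c s → (con (+ 1) :+ n) :* c :- (con (+ 0) :+ s) := c :+ (n :* c :- s)) refl (fromℕ n) c _)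

  weight-*ʳ : ∀ {n} (w : Fin n → Carrier) c S → weight (λ u → w u * c) S ≈ weight w S * c
  weight-*ʳ w c []          = sym (zeroˡ c)
  weight-*ʳ w c (true ∷ S)  = trans (+-congˡ (weight-*ʳ (w ∘ suc) c S))
    (solve 3 (λ a c s → a :* c :+ s :* c := (a :+ s) :* c) refl (w zero) c _)
  weight-*ʳ w c (false ∷ S) = trans (+-congˡ (weight-*ʳ (w ∘ suc) c S))
    (solve 2 (λ c s → con (+ 0) :+ s :* c := (con (+ 0) :+ s) :* c) refl c _)

  weight-natural : ∀ {n} {w : Fin n → Carrier} → (∀ u → w u ≈ 1#) → ∀ S → ∃ λ c → weight w S ≈ fromℕ c
  weight-natural w≈1 [] = 0 , refl
  weight-natural w≈1 (b ∷ S) with weight-natural (w≈1 ∘ suc) S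
  weight-natural w≈1 (true ∷ S)  | c , eq = suc c , +-cong (w≈1 zero) eq
  weight-natural w≈1 (false ∷ S) | c , eq = c , trans (+-identityˡ _) eq

  module SubmodularProperties {n : ℕ} {f : Subset n → Carrier}
      (submodular : IsSubmodular f) where

    marginal-antitone : ∀ {S T} u → (∀ v → lookup S v ≡ true → lookup T v ≡ true) →
      lookup T u ≡ false → f (T [ u ]≔ true) − f T ≤ f (S [ u ]≔ true) − f S
    marginal-antitone {S} {T} u S⊆T T∌u =
      ≡.subst₂ (λ T′ S′ → f T′ − f T ≤ f S′ − f S) (∪⁅⁆-≡ T u) (∪⁅⁆-≡ S u)
        (submodular S T u (λ {v} S∋v → lookup⇒[]= v T (S⊆T v ([]=⇒lookup S∋v)))
          λ T∋u → true≢false (≡.trans (≡.sym ([]=⇒lookup T∋u)) T∌u))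
      where
      true≢false : ¬ (true ≡ false)
      true≢false ()

    -- When the elements of `X` are added one by one, each gains no more than it would over `S`
    -- alone. One that is already present gains nothing, which is where `g` has to be nonnegative.
    gain≤marginals : ∀ S (g : Fin n → Carrier) → (∀ u → 0# ≤ g u) →
      (∀ u → lookup S u ≡ false → f (S [ u ]≔ true) − f S ≤ g u) →
      ∀ X → f (S ∪ X) ≤ f S + weight g X
    gain≤marginals S g 0≤g marginal≤g = subset-induction
      (λ X → f (S ∪ X) ≤ f S + weight g X)
      (≤-reflexive (trans (reflexive (≡.cong f (∪-identityʳ S)))
        (trans (sym (+-identityʳ _)) (+-congˡ (sym (weight-⊥ g)))))) step
      where
      step : ∀ X u → lookup X u ≡ false → f (S ∪ X) ≤ f S + weight g X →
             f (S ∪ (X [ u ]≔ true)) ≤ f S + weight g (X [ u ]≔ true)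
      step X u X∌u ih rewrite ∪-[]≔ S X u with lookup (S ∪ X) u in eq
      ... | true rewrite []≔-unchanged (S ∪ X) u eq =
        ≤-by (≤⇒0≤− ih ⊕⁰ 0≤g u) (trans (+-congʳ (+-congˡ (weight-insert g X u X∌u)))
          (solve 4 (λ a b w g → a :+ (w :+ g) :- b := (a :+ w :- b) :+ g) refl _ _ _ _))
      ... | false = ≤-by
        (≤⇒0≤− ih ⊕⁰ ≤⇒0≤− (≤-trans (marginal-antitone u (∪-⊇ˡ S X) eq) (marginal≤g u (∪-∌ˡ S X u eq))))
        (trans (+-congʳ (+-congˡ (weight-insert g X u X∌u)))
          (solve 5 (λ s w g b b′ → s :+ (w :+ g) :- b′ := (s :+ w :- b) :+ (g :- (b′ :- b))) refl _ _ _ _ _))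

    -- Elements of `X` in `T` but outside `S` have to be excluded: adding one leaves `T` unchanged
    -- but may lower f on the side of `S`. Every other element is new to both sides or to neither.
    gain-antitone : ∀ {S T} → (∀ v → lookup S v ≡ true → lookup T v ≡ true) →
      ∀ X → (∀ v → lookup X v ≡ true → lookup T v ≡ true → lookup S v ≡ true) →
      f (T ∪ X) − f T ≤ f (S ∪ X) − f S
    gain-antitone {S} {T} S⊆T = subset-induction
      (λ X → (∀ v → lookup X v ≡ true → lookup T v ≡ true → lookup S v ≡ true) →
             f (T ∪ X) − f T ≤ f (S ∪ X) − f S)
      base step
      where
      base : (∀ v → lookup {n = n} ⊥ v ≡ true → lookup T v ≡ true → lookup S v ≡ true) →
             f (T ∪ ⊥) − f T ≤ f (S ∪ ⊥) − f S
      base _ rewrite ∪-identityʳ T | ∪-identityʳ S = ≤-reflexive (trans (-‿inverseʳ _) (sym (-‿inverseʳ _)))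

      step : ∀ X u → lookup X u ≡ false →
        ((∀ v → lookup X v ≡ true → lookup T v ≡ true → lookup S v ≡ true) →
             f (T ∪ X) − f T ≤ f (S ∪ X) − f S) →
        (∀ v → lookup (X [ u ]≔ true) v ≡ true → lookup T v ≡ true → lookup S v ≡ true) →
             f (T ∪ (X [ u ]≔ true)) − f T ≤ f (S ∪ (X [ u ]≔ true)) − f S
      step X u X∌u ih X[u]∩T⊆S rewrite ∪-[]≔ S X u | ∪-[]≔ T X u with lookup (T ∪ X) u in eq
      ... | true rewrite []≔-unchanged (T ∪ X) u eq
                       | []≔-unchanged (S ∪ X) u (∪-⊇ˡ S X u
                           (X[u]∩T⊆S u (lookup∘update u X true) (∪-∋ˡ T X u X∌u eq))) =
        ih (λ v X∋v → X[u]∩T⊆S v ([]≔-true-⊇ X u v X∋v))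
      ... | false = ≤-by
        (≤⇒0≤− (ih (λ v X∋v → X[u]∩T⊆S v ([]≔-true-⊇ X u v X∋v)))
          ⊕⁰ ≤⇒0≤− (marginal-antitone u (∪-monoˡ S T X S⊆T) eq))
        (solve 6 (λ s s₁ s₂ t t₁ t₂ → (s₂ :- s) :- (t₂ :- t)
                   := (s₁ :- s :- (t₁ :- t)) :+ (s₂ :- s₁ :- (t₂ :- t₁))) refl _ _ _ _ _ _)

  module SymmetricSubmodularProperties {n : ℕ} {f : Subset n → Carrier}
      (nonNegative : ∀ S → 0# ≤ f S) (symmetric : IsSymmetric f) (submodular : IsSubmodular f) where
    open SubmodularProperties submodular

    -- By symmetry, deleting elements from S is the same as adding them to ∁ S.
    deletions-gain : ∀ S θ → 0# ≤ θ →
      (∀ u → lookup S u ≡ true → f (S [ u ]≔ false) − f S ≤ θ) →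
      ∀ X → f (∁ S ∪ X) ≤ f S + fromℕ n * θ
    deletions-gain S θ 0≤θ deletion≤θ X = ≤-trans
      (gain≤marginals (∁ S) (λ _ → θ) (λ _ → 0≤θ) marginal≤θ X)
      (≤-by (≤⇒0≤− (weight-const-≤ 0≤θ X) ⊕⁰ ≈⇒0≤− (sym (symmetric S)))
        (solve 4 (λ s w s′ w′ → (s :+ w) :- (s′ :+ w′) := (w :- w′) :+ (s :- s′)) refl _ _ _ _))
      where
      marginal≤θ : ∀ u → lookup (∁ S) u ≡ false → f (∁ S [ u ]≔ true) − f (∁ S) ≤ θ
      marginal≤θ u ∁S∌u = ≤-respˡ-≈
        (+-cong (trans (symmetric _) (reflexive (≡.cong f (map-[]≔ not S u)))) (-‿cong (symmetric S)))
        (deletion≤θ u (≡.trans (≡.sym (not-involutive _))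
          (≡.cong not (≡.trans (≡.sym (lookup-map u not S)) ∁S∌u))))

    -- The sets S ∪ X and ∁ S ∪ X meet in `X` and together cover everything, so this is
    -- submodularity with the nonnegative value of the whole ground set dropped. By symmetry the
    -- last term is f (S ∖ X).
    posimodular : ∀ S X → f X ≤ f (S ∪ X) + f (∁ S ∪ X)
    posimodular S X = ≤-by
      (≤⇒0≤− (gain-antitone {X} {∁ S ∪ X} X⊆∁S∪X S S∩[∁S∪X]⊆X)
        ⊕⁰ nonNegative ((∁ S ∪ X) ∪ S) ⊕⁰ ≈⇒0≤− (reflexive (≡.cong f (∪-comm X S))))
      (solve 5 (λ a b c d e → (a :+ b) :- c := ((e :- c) :- (d :- b)) :+ d :+ (a :- e)) refl _ _ _ _ _)
      where
      X⊆∁S∪X : ∀ v → lookup X v ≡ true → lookup (∁ S ∪ X) v ≡ true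
      X⊆∁S∪X v X∋v rewrite ∪-comm (∁ S) X = ∪-⊇ˡ X (∁ S) v X∋v
      S∩[∁S∪X]⊆X : ∀ v → lookup S v ≡ true → lookup (∁ S ∪ X) v ≡ true → lookup X v ≡ true
      S∩[∁S∪X]⊆X v S∋v ∁S∪X∋v rewrite ∪-comm (∁ S) X =
        ∪-∋ˡ X (∁ S) v (≡.trans (lookup-map v not S) (≡.cong not S∋v)) ∁S∪X∋v

-- Analysis of the moves

module Budget (R : RealField) (L : RealField.Carrier R) {n : ℕ} (I : Maximization.Instance R n) where
  open RealField R
  open Maximization R
  open Instance I

  -- For B = 0 the first inequality always holds and would bar all additions, although every element
  -- is then free. The second conjunct prevents this and licenses division by `B`.
  IsFull : Subset n → Set
  IsFull S = L * B ≤ fromℕ 2 * cost S × ¬ (B ≤ 0#)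

  isFull? : ∀ S → Dec (IsFull S)
  isFull? S = (L * B ≤? fromℕ 2 * cost S) ×-dec ¬? (B ≤? 0#)

  -- The analysis of the search is generic in β; the knapsack and the cardinality ratio enter it
  -- through this property.
  AdditionsFit : Carrier → Set
  AdditionsFit β = ∀ S u → cost S ≤ β * B → ¬ IsFull S → cost S + p u ≤ β * B

module LocalSearch (R : RealField) (δ L : RealField.Carrier R) {n : ℕ} (I : Maximization.Instance R n)
    (M : RealField.Carrier R) where
  open RealField R
  open RealFieldProperties R
  open Maximization R
  open Instance I
  open Budget R L I

  m : Carrier
  m = fromℕ (suc n)

  0≤m : 0# ≤ m
  0≤m = fromℕ-nonNeg (suc n)

  0<m : 0# < m
  0<m = fromℕ-suc-pos n

  -- A threshold of δM/m per deletion keeps the joint gain of all refused deletions within δM. It is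
  -- cleared of the division, which programs lack.
  Removable : Subset n → Fin n → Set
  Removable S u = δ * M ≤ m * (f (S [ u ]≔ false) − f S)

  -- That f does not decrease is demanded separately, since the density condition alone would admit
  -- losses when W - 2 f S is negative.
  Addable : Subset n → Carrier → Fin n → Set
  Addable S W u = ¬ IsFull S × (f S ≤ f (S [ u ]≔ true) ×
    p u * (W − fromℕ 2 * f S) ≤ B * (f (S [ u ]≔ true) − f S))

  data Move (S : Subset n) (W : Carrier) : Subset n → Set where
    removal  : ∀ u → lookup S u ≡ true → Removable S u → Move S W (S [ u ]≔ false)
    addition : ∀ u → lookup S u ≡ false → Addable S W u → Move S W (S [ u ]≔ true)

  Stuck : Subset n → Carrier → Fin n → Set
  Stuck S W u = (lookup S u ≡ true × ¬ Removable S u) ⊎ (lookup S u ≡ false × ¬ Addable S W u)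

  -- Every move, and every lowering of `W` by δM, raises this by at least δM. The factor 2 lets the
  -- gain of a removal, 2m (f S′ - f S) ≥ 2δM, pay for the element lost as well.
  potential : Subset n → Carrier → Carrier
  potential S W = δ * M * weight (λ _ → 1#) S + fromℕ 2 * (m * f S) − W

  record Assumptions (ε β : Carrier) (O : Subset n) : Set where
    field
      0≤δ           : 0# ≤ δ
      0<ε           : 0# < ε
      isLn          : IsLn (ε ⁻¹ * ½) L
      0≤α           : 0# ≤ ½ − ε − δ
      additions-fit : AdditionsFit β
      O-feasible    : IsFeasible O
      M≤fO          : M ≤ f O
      f⊥≤M          : f ⊥ ≤ M
      singleton≤M   : ∀ u → f (⊥ [ u ]≔ true) ≤ M

    0≤M : 0# ≤ M
    0≤M = ≤-trans (f-nonNegative ⊥) f⊥≤M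

  module Analysis {ε β : Carrier} {O : Subset n} (assumptions : Assumptions ε β O) where
    open Assumptions assumptions
    open SubmodularProperties f-submodular
    open SymmetricSubmodularProperties f-nonNegative f-symmetric f-submodular

    -- Starting from ∅, each element gains at most its singleton value, hence at most M. This makes
    -- m M a safe first guess for the optimum.
    f≤mM : ∀ S → f S ≤ m * M
    f≤mM S = ≤-trans (≡.subst (λ S′ → f S′ ≤ f ⊥ + weight (λ _ → M) S) (∪-identityˡ S)
        (gain≤marginals ⊥ (λ _ → M) (λ _ → 0≤M) (λ u _ → ≤-by (≤⇒0≤− (singleton≤M u) ⊕⁰ f-nonNegative ⊥)
          (solve 3 (λ a b c → a :- (b :- c) := (a :- b) :+ c) refl _ _ _)) S))
      (≤-by (≤⇒0≤− f⊥≤M ⊕⁰ ≤⇒0≤− (weight-const-≤ 0≤M S))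
        (solve 4 (λ a b n w → (con (+ 1) :+ n) :* a :- (b :+ w) := (a :- b) :+ (n :* a :- w)) refl M _ (fromℕ n) _))

    α : Carrier
    α = ½ − ε − δ

    0≤fO : 0# ≤ f O
    0≤fO = f-nonNegative O

    0≤1−2ε : 0# ≤ 1# − fromℕ 2 * ε
    0≤1−2ε = ≤-respʳ-≈ (trans
      (solve 4 (λ t h e d → t :* ((h :- e :- d) :+ d) := t :* h :- t :* e) refl (fromℕ 2) ½ ε δ)
      (+-congʳ ½-double)) (fromℕ-nonNeg 2 ⊗⁰ (0≤α ⊕⁰ 0≤δ))

    Finished : Subset n → Set
    Finished S = α * f O ≤ f S

    -- The factor 1 − 2ε is what a full set achieves; other sets do better.
    finished : ∀ {S W} → f O − fromℕ 2 * (δ * M) ≤ W →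
               (1# − fromℕ 2 * ε) * W ≤ fromℕ 2 * f S → Finished S
    finished {S} {W} W-large W≤2f = *-cancel-≤ (fromℕ-suc-pos 1) (≤-by
      (≤⇒0≤− W≤2f ⊕⁰ 0≤1−2ε ⊗⁰ ≤⇒0≤− W-large ⊕⁰ fromℕ-nonNeg 2 ⊗⁰ (0≤δ ⊗⁰ ≤⇒0≤− M≤fO)
        ⊕⁰ fromℕ-nonNeg 4 ⊗⁰ (proj₁ 0<ε ⊗⁰ (0≤δ ⊗⁰ 0≤M)) ⊕⁰ ≈⇒0≤− ½-double ⊗⁰ 0≤fO)
      (solve 7 (λ h e d o s w m →
         con (+ 2) :* s :- con (+ 2) :* ((h :- e :- d) :* o)
         := (con (+ 2) :* s :- (con (+ 1) :- con (+ 2) :* e) :* w)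
            :+ (con (+ 1) :- con (+ 2) :* e) :* (w :- (o :- con (+ 2) :* (d :* m)))
            :+ con (+ 2) :* (d :* (o :- m)) :+ con (+ 4) :* (e :* (d :* m))
            :+ (con (+ 1) :- con (+ 2) :* h) :* o) refl ½ ε δ (f O) (f S) W M))

    -- For W ≥ 0 the factor 1 - 2ε only helps; for W ≤ 0 the product (1 - 2ε) W is not positive and
    -- f is nonnegative.
    W≤2f⇒finished : ∀ {S W} → f O − fromℕ 2 * (δ * M) ≤ W → W ≤ fromℕ 2 * f S → Finished S
    W≤2f⇒finished {S} {W} W-large W≤2f with total 0# W
    ... | inj₁ 0≤W = finished W-large (≤-by (≤⇒0≤− W≤2f ⊕⁰ fromℕ-nonNeg 2 ⊗⁰ (proj₁ 0<ε ⊗⁰ 0≤W))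
      (solve 3 (λ e w s → s :- (con (+ 1) :- con (+ 2) :* e) :* w := s :- w :+ con (+ 2) :* (e :* w)) refl ε W _))
    ... | inj₂ W≤0 = finished W-large (≤-by (0≤1−2ε ⊗⁰ ≤⇒0≤− W≤0 ⊕⁰ fromℕ-nonNeg 2 ⊗⁰ f-nonNegative S)
      (solve 3 (λ c w s → s :- c :* w := c :* (con (+ 0) :- w) :+ s) refl _ W _))

    relativeCost : Subset n → Carrier
    relativeCost S = fromℕ 2 * B ⁻¹ * cost S

    -- The discrete form of W − 2 f S ≤ exp (− 2 (cost S / B)) W.
    Quality : Subset n → Carrier → Set
    Quality S W = 0# < B →
      W ≤ fromℕ 2 * f S ⊎ (∀ i → expApprox (relativeCost S) i * (W − fromℕ 2 * f S) ≤ W)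

    Invariant : Subset n → Carrier → Set
    Invariant S W = cost S ≤ β * B × Quality S W

    module _ (0<B : 0# < B) where
      rate-nonNeg : 0# ≤ fromℕ 2 * B ⁻¹
      rate-nonNeg = fromℕ-nonNeg 2 ⊗⁰ ⁻¹-nonNeg 0<B

      relativeCost-nonNeg : ∀ S → 0# ≤ relativeCost S
      relativeCost-nonNeg S = rate-nonNeg ⊗⁰ weight-nonNeg p-nonNegative S

      B⁻¹*B : B * B ⁻¹ ≈ 1#
      B⁻¹*B = ⁻¹-inverse 0<B

    f-removal-≤ : ∀ S u → Removable S u → f S ≤ f (S [ u ]≔ false)
    f-removal-≤ S u removable = *-cancel-≤ 0<m (≤-by (0≤δ ⊗⁰ 0≤M ⊕⁰ ≤⇒0≤− removable)
      (solve 4 (λ d m s s′ → m :* s′ :- m :* s := d :+ (m :* (s′ :- s) :- d)) refl (δ * M) m _ _))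

    move-f-≤ : ∀ {S W S′} → Move S W S′ → f S ≤ f S′
    move-f-≤ {S} (removal u _ removable)    = f-removal-≤ S u removable
    move-f-≤ (addition u _ (_ , fS≤fS′ , _)) = fS≤fS′

    move-potential : ∀ {S W S′} → Move S W S′ → potential S W + δ * M ≤ potential S′ W
    move-potential {S} {W} (removal u S∋u removable) = ≤-by
      (fromℕ-nonNeg 2 ⊗⁰ ≤⇒0≤− removable ⊕⁰ 0≤δ ⊗⁰ 0≤M ⊗⁰ ≈⇒0≤− (weight-remove (λ _ → 1#) S u S∋u))
      (solve 7 (λ d c c′ m s s′ w →
        d :* c′ :+ con (+ 2) :* (m :* s′) :- w :- (d :* c :+ con (+ 2) :* (m :* s) :- w :+ d)
        := con (+ 2) :* (m :* (s′ :- s) :- d) :+ d :* (c′ :+ con (+ 1) :- c))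
        refl (δ * M) _ _ m _ _ W)
    move-potential {S} {W} (addition u S∌u (_ , fS≤fS′ , _)) = ≤-by
      (fromℕ-nonNeg 2 ⊗⁰ (0≤m ⊗⁰ ≤⇒0≤− fS≤fS′)
        ⊕⁰ 0≤δ ⊗⁰ 0≤M ⊗⁰ ≈⇒0≤− (sym (weight-insert (λ _ → 1#) S u S∌u)))
      (solve 7 (λ d c c′ m s s′ w →
        d :* c′ :+ con (+ 2) :* (m :* s′) :- w :- (d :* c :+ con (+ 2) :* (m :* s) :- w :+ d)
        := con (+ 2) :* (m :* (s′ :- s)) :+ d :* (c′ :- (c :+ con (+ 1))))
        refl (δ * M) _ _ m _ _ W)

    -- A removal raises f and lowers the cost, so the gap W - 2 f S and the exponential both shrink.
    -- An addition multiplies the gap by at most 1 - y, where y = 2 p u / B, and the exponential by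
    -- at most exp y, and exp y (1 - y) ≤ 1. Products with the gap are monotone only while it is
    -- nonnegative; once W ≤ 2 f S′, the first alternative of `Quality` takes over.
    move-invariant : ∀ {S W S′} → Move S W S′ → Invariant S W → Invariant S′ W
    move-invariant {S} {W} (removal u S∋u removable) (fits , quality) =
      ≤-trans cost-decreases fits , λ 0<B → weaken 0<B (quality 0<B)
      where
      S′ = S [ u ]≔ false
      cost-decreases : cost S′ ≤ cost S
      cost-decreases = ≤-by (p-nonNegative u) (trans (+-congʳ (weight-remove p S u S∋u))
        (solve 2 (λ a b → a :+ b :- a := b) refl _ _))
      weaken : 0# < B → W ≤ fromℕ 2 * f S ⊎ (∀ i → expApprox (relativeCost S) i * (W − fromℕ 2 * f S) ≤ W) →
        W ≤ fromℕ 2 * f S′ ⊎ (∀ i → expApprox (relativeCost S′) i * (W − fromℕ 2 * f S′) ≤ W)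
      weaken 0<B (inj₁ W≤2f) = inj₁ (≤-trans W≤2f (*-monoʳ-≤ (fromℕ-nonNeg 2) (f-removal-≤ S u removable)))
      weaken 0<B (inj₂ h) with W ≤? fromℕ 2 * f S′
      ... | yes W≤2f′ = inj₁ W≤2f′
      ... | no  W≰2f′ = inj₂ λ i → ≤-trans
        (*-monoˡ-≤ (≤⇒0≤− (≰⇒≥ W≰2f′)) (expApprox-mono i
          (nonNeg⇒expStep-nonNeg i (relativeCost-nonNeg 0<B S′)) (*-monoʳ-≤ (rate-nonNeg 0<B) cost-decreases)))
        (≤-trans (*-monoʳ-≤ (^-nonNeg (suc i) (nonNeg⇒expStep-nonNeg i (relativeCost-nonNeg 0<B S)))
          (≤-by (fromℕ-nonNeg 2 ⊗⁰ ≤⇒0≤− (f-removal-≤ S u removable))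
            (solve 3 (λ w s s′ → (w :- con (+ 2) :* s) :- (w :- con (+ 2) :* s′) := con (+ 2) :* (s′ :- s)) refl W _ _)))
          (h i))
    move-invariant {S} {W} (addition u S∌u (¬full , fS≤fS′ , dense)) (fits , quality) =
      ≤-trans (≤-reflexive (weight-insert p S u S∌u)) (additions-fit S u fits ¬full)
      , λ 0<B → extend 0<B (quality 0<B)
      where
      S′ = S [ u ]≔ true
      extend : 0# < B → W ≤ fromℕ 2 * f S ⊎ (∀ i → expApprox (relativeCost S) i * (W − fromℕ 2 * f S) ≤ W) →
        W ≤ fromℕ 2 * f S′ ⊎ (∀ i → expApprox (relativeCost S′) i * (W − fromℕ 2 * f S′) ≤ W)
      extend 0<B (inj₁ W≤2f) = inj₁ (≤-trans W≤2f (*-monoʳ-≤ (fromℕ-nonNeg 2) fS≤fS′))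
      extend 0<B (inj₂ h) with W ≤? fromℕ 2 * f S′
      ... | yes W≤2f′ = inj₁ W≤2f′
      ... | no  W≰2f′ = inj₂ shrinks
        where
        open PartialOrderReasoning poset
        y    = fromℕ 2 * B ⁻¹ * p u
        gap  = W − fromℕ 2 * f S
        gap′ = W − fromℕ 2 * f S′
        0≤gap′ = ≤⇒0≤− (≰⇒≥ W≰2f′)
        0≤gap = ≤-trans 0≤gap′ (≤-by (fromℕ-nonNeg 2 ⊗⁰ ≤⇒0≤− fS≤fS′)
          (solve 3 (λ w s s′ → (w :- con (+ 2) :* s) :- (w :- con (+ 2) :* s′) := con (+ 2) :* (s′ :- s)) refl W _ _))
        0≤x = relativeCost-nonNeg 0<B S
        0≤y = rate-nonNeg 0<B ⊗⁰ p-nonNegative u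
        relativeCost-S′ : relativeCost S′ ≈ relativeCost S + y
        relativeCost-S′ = trans (*-congˡ (weight-insert p S u S∌u))
          (solve 3 (λ a b c → a :* (b :+ c) := a :* b :+ a :* c) refl _ _ _)
        -- The density condition times 2 / B says 2 (f S′ - f S) ≥ y gap.
        gap-shrinks : gap′ ≤ (1# − y) * gap
        gap-shrinks = ≤-by (rate-nonNeg 0<B ⊗⁰ ≤⇒0≤− dense
            ⊕⁰ ≈⇒0≤− (B⁻¹*B 0<B) ⊗⁰ (fromℕ-nonNeg 2 ⊗⁰ ≤⇒0≤− fS≤fS′))
          (solve 6 (λ b j p w s s′ →
              (con (+ 1) :- con (+ 2) :* j :* p) :* (w :- con (+ 2) :* s) :- (w :- con (+ 2) :* s′)
              := con (+ 2) :* j :* (b :* (s′ :- s) :- p :* (w :- con (+ 2) :* s))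
                 :+ (con (+ 1) :- b :* j) :* (con (+ 2) :* (s′ :- s)))
            refl B (B ⁻¹) (p u) W _ _)
        shrinks : ∀ i → expApprox (relativeCost S′) i * gap′ ≤ W
        shrinks i = begin
          expApprox (relativeCost S′) i * gap′            ≈⟨ *-congʳ (^-congˡ (suc i) (+-congˡ (*-congʳ relativeCost-S′))) ⟩
          expApprox (relativeCost S + y) i * gap′         ≤⟨ *-monoˡ-≤ 0≤gap′ (expApprox-+ i 0≤x 0≤y) ⟩
          Ex * Ey * gap′                                  ≤⟨ *-monoʳ-≤ (0≤Ex ⊗⁰ 0≤Ey) gap-shrinks ⟩
          Ex * Ey * ((1# − y) * gap)                      ≈⟨ solve 4 (λ a b c d → a :* b :* (c :* d) := b :* c :* (a :* d))
                                                               refl Ex Ey _ gap ⟩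
          Ey * (1# − y) * (Ex * gap)                      ≤⟨ *-monoˡ-≤ (0≤Ex ⊗⁰ 0≤gap) (expApprox-decay i 0≤y) ⟩
          1# * (Ex * gap)                                 ≈⟨ *-identityˡ _ ⟩
          Ex * gap                                        ≤⟨ h i ⟩
          W                                               ∎
          where
          Ex = expApprox (relativeCost S) i
          Ey = expApprox y i
          0≤Ex = ^-nonNeg (suc i) (nonNeg⇒expStep-nonNeg i 0≤x)
          0≤Ey = ^-nonNeg (suc i) (nonNeg⇒expStep-nonNeg i 0≤y)

    -- The left side of the bound falls by `d` times the exponential, which is at least 1, and the
    -- right side only by `d`.
    decrease-invariant : ∀ {S W d} → 0# ≤ d → Invariant S W → Invariant S (W − d)
    decrease-invariant {S} {W} {d} 0≤d (fits , quality) = fits , λ 0<B → decrease 0<B (quality 0<B)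
      where
      decrease : 0# < B → W ≤ fromℕ 2 * f S ⊎ (∀ i → expApprox (relativeCost S) i * (W − fromℕ 2 * f S) ≤ W) →
        W − d ≤ fromℕ 2 * f S ⊎ (∀ i → expApprox (relativeCost S) i * (W − d − fromℕ 2 * f S) ≤ W − d)
      decrease 0<B (inj₁ W≤2f) = inj₁ (≤-by (≤⇒0≤− W≤2f ⊕⁰ 0≤d)
        (solve 3 (λ w d s → s :- (w :- d) := s :- w :+ d) refl W d _))
      decrease 0<B (inj₂ h) = inj₂ λ i → ≤-by
        (≤⇒0≤− (h i) ⊕⁰ ≤⇒0≤− (1≤expApprox i (relativeCost-nonNeg 0<B S)) ⊗⁰ 0≤d)
        (solve 4 (λ w d s e → w :- d :- e :* (w :- d :- s) := w :- e :* (w :- s) :+ (e :- con (+ 1)) :* d) refl W d _ _)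

    -- A full set has relative cost at least `L`, where the exponential reaches 1 / (2ε); hence W -
    -- 2 f S ≤ 2ε W.
    full⇒finished : ∀ {S W} → f O − fromℕ 2 * (δ * M) ≤ W → Invariant S W → IsFull S → Finished S
    full⇒finished {S} {W} W-large (_ , quality) (LB≤2c , B≰0) with W ≤? fromℕ 2 * f S
    ... | yes W≤2f = W≤2f⇒finished W-large W≤2f
    ... | no  W≰2f with quality (≰⇒> B≰0)
    ...   | inj₁ W≤2f = ⊥-elim (W≰2f W≤2f)
    ...   | inj₂ h = finished W-large (≤-by
      (≤⇒0≤− (exp-ln-≤ 0<ε isLn L≤relativeCost (≤⇒0≤− (≰⇒≥ W≰2f)) h))
      (solve 3 (λ e w s → s :- (con (+ 1) :- con (+ 2) :* e) :* w := con (+ 2) :* e :* w :- (w :- s)) refl ε W _))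
      where
      0<B = ≰⇒> B≰0
      L≤relativeCost : L ≤ relativeCost S
      L≤relativeCost = *-cancel-≤ 0<B (≤-trans (≤-reflexive (*-comm B L)) (≤-trans LB≤2c (≤-reflexive
        (trans (sym (*-identityˡ _)) (trans (*-congʳ (sym (⁻¹-inverse 0<B)))
          (solve 4 (λ b j t c → b :* j :* (t :* c) := b :* (t :* j :* c)) refl B (B ⁻¹) (fromℕ 2) (cost S)))))))

    -- By posimodularity f O ≤ f (S ∪ O) + f (∁ S ∪ O). The first term is at most f S + c cost O ≤ f
    -- S + (W - 2 f S), the second at most f S + n θ ≤ f S + δM; the sum is W + δM.
    stuck⇒W-large : ∀ {S W} → ¬ IsFull S → fromℕ 2 * f S ≤ W → (∀ u → Stuck S W u) → f O − δ * M ≤ W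
    stuck⇒W-large {S} {W} ¬full 2f≤W stuck = ≤-by
      (≤⇒0≤− (posimodular S O) ⊕⁰ ≤⇒0≤− (deletions-gain S θ 0≤θ deletion≤θ O)
        ⊕⁰ ≤⇒0≤− (gain≤marginals S (λ u → p u * c) (λ u → p-nonNegative u ⊗⁰ 0≤c) marginal≤ O)
        ⊕⁰ 0≤θ ⊕⁰ ≈⇒0≤− mθ≈δM ⊕⁰ ≈⇒0≤− (weight-*ʳ p c O)
        ⊕⁰ ≤⇒0≤− (*-monoˡ-≤ 0≤c O-feasible) ⊕⁰ ≤⇒0≤− Bc≤gap)
      (solve 12 (λ w o d s∪o cs∪o s n t wt bc co c →
        w :- (o :- d)
        := s∪o :+ cs∪o :- o :+ (s :+ n :* t :- cs∪o) :+ (s :+ wt :- s∪o) :+ t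
           :+ (d :- (con (+ 1) :+ n) :* t) :+ (co :* c :- wt) :+ (bc :- co :* c)
           :+ ((w :- con (+ 2) :* s) :- bc))
        refl W (f O) (δ * M) _ _ (f S) (fromℕ n) θ _ (B * c) (cost O) c)
      where
      gap = W − fromℕ 2 * f S
      θ = δ * M * m ⁻¹
      0≤θ : 0# ≤ θ
      0≤θ = 0≤δ ⊗⁰ 0≤M ⊗⁰ ⁻¹-nonNeg 0<m
      mθ≈δM : m * θ ≈ δ * M
      mθ≈δM = trans (solve 3 (λ m j d → m :* (d :* j) := m :* j :* d) refl m (m ⁻¹) (δ * M))
        (trans (*-congʳ (⁻¹-inverse 0<m)) (*-identityˡ _))

      deletion≤θ : ∀ u → lookup S u ≡ true → f (S [ u ]≔ false) − f S ≤ θ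
      deletion≤θ u S∋u with stuck u
      ... | inj₁ (_ , ¬removable) = *-cancel-≤ 0<m (≤-trans (≰⇒≥ ¬removable) (≤-reflexive (sym mθ≈δM)))
      ... | inj₂ (S∌u , _) with () ← ≡.trans (≡.sym S∋u) S∌u

      -- A bound on the marginals per unit of cost, namely gap / B if B > 0. If B = 0 all costs
      -- vanish, so every element that does not lower f passes the density test, the rejected ones
      -- have no positive marginal, and 0 will do.
      density : ∃ λ c → 0# ≤ c × B * c ≤ gap ×
        (∀ u → lookup S u ≡ false → ¬ Addable S W u → f (S [ u ]≔ true) − f S ≤ p u * c)
      density with B ≤? 0#
      ... | yes B≤0 = 0# , ≤-refl , ≤-trans (≤-reflexive (zeroʳ B)) (≤⇒0≤− 2f≤W) , marginal≤0
        where
        marginal≤0 : ∀ u → lookup S u ≡ false → ¬ Addable S W u → f (S [ u ]≔ true) − f S ≤ p u * 0#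
        marginal≤0 u _ ¬addable with f S ≤? f (S [ u ]≔ true)
        ... | no fS≰fS′ = ≤-by (≤⇒0≤− (≰⇒≥ fS≰fS′))
          (solve 3 (λ p s s′ → p :* con (+ 0) :- (s′ :- s) := s :- s′) refl (p u) _ _)
        ... | yes fS≤fS′ = ⊥-elim (¬addable (¬full , fS≤fS′ , ≤-by
          (≤⇒0≤− (≤-trans (p≤B u) B≤0) ⊗⁰ ≤⇒0≤− 2f≤W ⊕⁰ B-nonNegative ⊗⁰ ≤⇒0≤− fS≤fS′)
          (solve 4 (λ b p g d → b :* d :- p :* g := (con (+ 0) :- p) :* g :+ b :* d) refl B (p u) _ _)))
      ... | no B≰0 = gap * B ⁻¹ , 0≤gap/B , ≤-reflexive B*gap/B , marginal≤density
        where
        0<B = ≰⇒> B≰0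
        0≤gap/B = ≤⇒0≤− 2f≤W ⊗⁰ ⁻¹-nonNeg 0<B
        B*gap/B : B * (gap * B ⁻¹) ≈ gap
        B*gap/B = trans (solve 3 (λ b g j → b :* (g :* j) := b :* j :* g) refl B gap (B ⁻¹))
          (trans (*-congʳ (⁻¹-inverse 0<B)) (*-identityˡ gap))
        marginal≤density : ∀ u → lookup S u ≡ false → ¬ Addable S W u →
          f (S [ u ]≔ true) − f S ≤ p u * (gap * B ⁻¹)
        marginal≤density u _ ¬addable with f S ≤? f (S [ u ]≔ true)
        ... | no fS≰fS′ = ≤-by (≤⇒0≤− (≰⇒≥ fS≰fS′) ⊕⁰ p-nonNegative u ⊗⁰ 0≤gap/B)
          (solve 3 (λ g s s′ → g :- (s′ :- s) := s :- s′ :+ g) refl _ _ _)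
        ... | yes fS≤fS′ with p u * gap ≤? B * (f (S [ u ]≔ true) − f S)
        ...   | yes dense = ⊥-elim (¬addable (¬full , fS≤fS′ , dense))
        ...   | no ¬dense = *-cancel-≤ 0<B (≤-trans (≰⇒≥ ¬dense) (≤-reflexive
          (trans (*-congˡ (sym B*gap/B)) (solve 3 (λ b p g → p :* (b :* g) := b :* (p :* g)) refl B (p u) _))))

      c = proj₁ density
      0≤c = proj₁ (proj₂ density)
      Bc≤gap = proj₁ (proj₂ (proj₂ density))

      marginal≤ : ∀ u → lookup S u ≡ false → f (S [ u ]≔ true) − f S ≤ p u * c
      marginal≤ u S∌u with stuck u
      ... | inj₁ (S∋u , _) with () ← ≡.trans (≡.sym S∋u) S∌u
      ... | inj₂ (_ , ¬addable) = proj₂ (proj₂ (proj₂ density)) u S∌u ¬addable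

    -- The slack is 2δM because a stuck set shows W ≥ f O - δM just before `W` drops by δM.
    -- `Finished` persists, since moves never decrease f.
    Progress : Carrier → Subset n → Carrier → Set
    Progress t S W = Finished S ⊎ (f O − fromℕ 2 * (δ * M) ≤ W × t ≤ potential S W)

    move-progress : ∀ {S W S′ t} → Move S W S′ → Progress t S W → Progress (t + δ * M) S′ W
    move-progress move (inj₁ fin) = inj₁ (≤-trans fin (move-f-≤ move))
    move-progress {S} {W} {S′} {t} move (inj₂ (W-large , t≤Φ)) = inj₂ (W-large ,
      ≤-trans (≤-by (≤⇒0≤− t≤Φ) (solve 3 (λ t p d → p :+ d :- (t :+ d) := p :- t) refl t _ _))
        (move-potential move))

    weaken-progress : ∀ {S W t t′} → t′ ≤ t → Progress t S W → Progress t′ S W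
    weaken-progress t′≤t (inj₁ fin)             = inj₁ fin
    weaken-progress t′≤t (inj₂ (W-large , t≤Φ)) = inj₂ (W-large , ≤-trans t′≤t t≤Φ)

    -- A full set, or one with W ≤ 2 f S, is already good enough. In the remaining case
    -- `stuck⇒W-large` makes it safe to lower `W`, which raises the potential by δM.
    stuck-progress : ∀ {S W t} → Invariant S W → (∀ u → Stuck S W u) →
                     Progress t S W → Progress (t + δ * M) S (W − δ * M)
    stuck-progress inv stuck (inj₁ fin) = inj₁ fin
    stuck-progress {S} {W} {t} inv stuck (inj₂ (W-large , t≤Φ)) with isFull? S
    ... | yes full = inj₁ (full⇒finished W-large inv full)
    ... | no ¬full with total W (fromℕ 2 * f S)
    ...   | inj₁ W≤2f = inj₁ (W≤2f⇒finished W-large W≤2f)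
    ...   | inj₂ 2f≤W = inj₂
      ( ≤-by (≤⇒0≤− (stuck⇒W-large ¬full 2f≤W stuck))
          (solve 3 (λ o w d → w :- d :- (o :- con (+ 2) :* d) := w :- (o :- d)) refl (f O) W _)
      , ≤-by (≤⇒0≤− t≤Φ) (solve 4 (λ a w d t → a :- (w :- d) :- (t :+ d) := a :- w :- t) refl _ W _ t))

    progress-−0 : ∀ {S W t} → Progress t S W → Progress t S (W − 0#)
    progress-−0 (inj₁ fin) = inj₁ fin
    progress-−0 {S} {W} {t} (inj₂ (W-large , t≤Φ)) = inj₂
      ( ≤-trans W-large (≤-reflexive (sym W−0≈W))
      , ≤-trans t≤Φ (≤-reflexive (+-congˡ (-‿cong (sym W−0≈W)))))
      where
      W−0≈W : W − 0# ≈ W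
      W−0≈W = solve 1 (λ w → w :- con (+ 0) := w) refl W

    -- The potential is at most 2m²M + δM n - f O + 2δM, whereas the bound reached is at least (4 +
    -- 3δ) m²M - mM. For M > 0 this is impossible; and if M = 0, then f O ≤ m M = 0 and any set will
    -- do.
    progress⇒finished : ∀ {S W k} → fromℕ 4 + fromℕ 3 * δ ≤ δ * k →
      Progress (- (m * M) + k * (m * m) * (δ * M)) S W → Finished S
    progress⇒finished _ (inj₁ fin) = fin
    progress⇒finished {S} {W} {k} k-large (inj₂ (W-large , t≤Φ)) = ≤-trans
      (≤-by (0≤α ⊗⁰ (≤⇒0≤− (f≤mM O) ⊕⁰ 0≤m ⊗⁰ ≤⇒0≤− M≤0))
        (solve 4 (λ a o m x → con (+ 0) :- a :* o := a :* (m :* x :- o :+ m :* (con (+ 0) :- x))) refl α (f O) m M))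
      (f-nonNegative S)
      where
      M≤0 : M ≤ 0#
      M≤0 = ≤-by
        (≤⇒0≤− t≤Φ ⊕⁰ 0≤δ ⊗⁰ 0≤M ⊗⁰ ≤⇒0≤− (weight-const-≤ 0≤1 S)
          ⊕⁰ fromℕ-nonNeg 2 ⊗⁰ (0≤m ⊗⁰ ≤⇒0≤− (f≤mM S)) ⊕⁰ ≤⇒0≤− W-large ⊕⁰ 0≤fO
          ⊕⁰ ≤⇒0≤− k-large ⊗⁰ (0≤m ⊗⁰ 0≤m) ⊗⁰ 0≤M
          -- The coefficient is what remains of (4 + 3δ) m² - m - 2m² - δ (n + 2), with m = n + 1,
          -- after 1 is set aside.
          ⊕⁰ 0≤M ⊗⁰ (fromℕ-nonNeg 3 ⊗⁰ 0≤n ⊕⁰ fromℕ-nonNeg 2 ⊗⁰ (0≤n ⊗⁰ 0≤n)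
                      ⊕⁰ 0≤δ ⊗⁰ (0≤1 ⊕⁰ fromℕ-nonNeg 5 ⊗⁰ 0≤n ⊕⁰ fromℕ-nonNeg 3 ⊗⁰ (0≤n ⊗⁰ 0≤n))))
        (solve 8 (λ x d n w o s f k →
          let m = con (+ 1) :+ n in
          con (+ 0) :- x
          := d :* x :* s :+ con (+ 2) :* (m :* f) :- w :- (:- (m :* x) :+ k :* (m :* m) :* (d :* x))
             :+ d :* x :* (n :* con (+ 1) :- s) :+ con (+ 2) :* (m :* (m :* x :- f))
             :+ (w :- (o :- con (+ 2) :* (d :* x))) :+ o
             :+ (d :* k :- (con (+ 4) :+ con (+ 3) :* d)) :* (m :* m) :* x
             :+ x :* (con (+ 3) :* n :+ con (+ 2) :* (n :* n)
                :+ d :* (con (+ 1) :+ con (+ 5) :* n :+ con (+ 3) :* (n :* n))))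
          refl M δ (fromℕ n) W (f O) _ (f S) k)
        where 0≤n = fromℕ-nonNeg n

    initial-progress : ∀ {W} → W ≈ m * M → Progress (- (m * M)) ⊥ W
    initial-progress {W} W≈mM = inj₂
      ( ≤-by (≤⇒0≤− (f≤mM O) ⊕⁰ ≈⇒0≤− (sym W≈mM) ⊕⁰ fromℕ-nonNeg 2 ⊗⁰ (0≤δ ⊗⁰ 0≤M))
          (solve 4 (λ w x o d → w :- (o :- d) := x :- o :+ (w :- x) :+ d) refl W (m * M) (f O) _)
      , ≤-by (0≤δ ⊗⁰ 0≤M ⊗⁰ weight-nonNeg {n} (λ _ → 0≤1) ⊥ ⊕⁰ fromℕ-nonNeg 2 ⊗⁰ (0≤m ⊗⁰ f-nonNegative ⊥)
          ⊕⁰ ≈⇒0≤− W≈mM)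
          (solve 4 (λ a b w x → a :+ b :- w :- (:- x) := a :+ b :+ (x :- w)) refl _ _ W (m * M)))

    -- At cost 0 every approximation of the exponential equals 1.
    initial-invariant : ∀ {W} → 0# ≤ β * B → Invariant ⊥ W
    initial-invariant {W} 0≤βB = ≤-trans (≤-reflexive (weight-⊥ p)) 0≤βB , λ 0<B → inj₂ λ i → ≤-by
      (fromℕ-nonNeg 2 ⊗⁰ f-nonNegative ⊥) (trans
        (+-congˡ (-‿cong (trans (*-congʳ (expApprox≈1 i)) (*-identityˡ _))))
        (solve 2 (λ w s → w :- (w :- s) := s) refl W _))
      where
      expApprox≈1 : ∀ i → expApprox (relativeCost ⊥) i ≈ 1#
      expApprox≈1 i = trans (^-congˡ (suc i)
        (trans (+-congˡ (trans (*-congʳ (trans (*-congˡ (weight-⊥ p)) (zeroʳ _))) (zeroˡ _))) (+-identityʳ 1#)))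
        (1^ (suc i))

-- The program

polynomial-const : ∀ c → IsPolynomiallyBounded (λ _ → c)
polynomial-const c = c , 0 , λ _ → ℕ.≤-reflexive (≡.sym (ℕ.*-identityʳ c))

polynomial-id : IsPolynomiallyBounded id
polynomial-id = 1 , 1 , λ n → ℕ.≤-trans (ℕ.n≤1+n n)
  (ℕ.≤-reflexive (≡.sym (≡.trans (ℕ.*-identityˡ _) (ℕ.*-identityʳ _))))

polynomial-+ : ∀ {S T} → IsPolynomiallyBounded S → IsPolynomiallyBounded T →
               IsPolynomiallyBounded (λ n → S n ℕ.+ T n)
polynomial-+ (c , d , S≤) (c′ , d′ , T≤) = c ℕ.+ c′ , d ℕ.+ d′ , λ n → ℕ.≤-trans
  (ℕ.+-mono-≤
    (ℕ.≤-trans (S≤ n) (ℕ.*-monoʳ-≤ c (ℕ.^-monoʳ-≤ (suc n) (ℕ.m≤m+n d d′))))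
    (ℕ.≤-trans (T≤ n) (ℕ.*-monoʳ-≤ c′ (ℕ.^-monoʳ-≤ (suc n) (ℕ.m≤n+m d′ d)))))
  (ℕ.≤-reflexive (≡.sym (ℕ.*-distribʳ-+ (suc n ℕ.^ (d ℕ.+ d′)) c c′)))

polynomial-* : ∀ {S T} → IsPolynomiallyBounded S → IsPolynomiallyBounded T →
               IsPolynomiallyBounded (λ n → S n ℕ.* T n)
polynomial-* (c , d , S≤) (c′ , d′ , T≤) = c ℕ.* c′ , d ℕ.+ d′ , λ n → ℕ.≤-trans
  (ℕ.*-mono-≤ (S≤ n) (T≤ n))
  (ℕ.≤-reflexive (≡.trans
    (ℕ.[m*n]*[o*p]≡[m*o]*[n*p] c (suc n ℕ.^ d) c′ _)
    (≡.cong (c ℕ.* c′ ℕ.*_) (≡.sym (ℕ.^-distribˡ-+-* (suc n) d d′)))))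

-- Only meaningful for programs without while loops.
timeBound : ∀ {k} → Command k → ℕ → ℕ
timeBound skip                n = 1
timeBound (x ≔ e)             n = suc (exprTime e)
timeBound (insert i X)        n = 1
timeBound (delete i X)        n = 1
timeBound (c ⨾ c′)            n = timeBound c n ℕ.+ timeBound c′ n
timeBound (ifThenElse b c c′) n = testTime b ℕ.+ (timeBound c n ℕ.+ timeBound c′ n)
timeBound (while b c)         n = 0
timeBound (forEach c)         n = suc (n ℕ.* suc (timeBound c n))

timeBound-polynomial : ∀ {k} (c : Command k) → IsPolynomiallyBounded (timeBound c)
timeBound-polynomial skip                = polynomial-const 1
timeBound-polynomial (x ≔ e)             = polynomial-const (suc (exprTime e))
timeBound-polynomial (insert i X)        = polynomial-const 1
timeBound-polynomial (delete i X)        = polynomial-const 1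
timeBound-polynomial (c ⨾ c′)            = polynomial-+ (timeBound-polynomial c) (timeBound-polynomial c′)
timeBound-polynomial (ifThenElse b c c′) = polynomial-+ (polynomial-const (testTime b))
  (polynomial-+ (timeBound-polynomial c) (timeBound-polynomial c′))
timeBound-polynomial (while b c)         = polynomial-const 0
timeBound-polynomial (forEach c)         = polynomial-+ (polynomial-const 1)
  (polynomial-* polynomial-id (polynomial-+ (polynomial-const 1) (timeBound-polynomial c)))

WhileFree : ∀ {k} → Command k → Set
WhileFree (c ⨾ c′)            = WhileFree c × WhileFree c′
WhileFree (ifThenElse b c c′) = WhileFree c × WhileFree c′
WhileFree (while b c)         = Empty.⊥
WhileFree (forEach c)         = WhileFree c
WhileFree _                   = ⊤

-- Execution of programs without while loops

module Running (R : RealField) (par : Parameter → RealField.Carrier R) {n : ℕ} (I : Maximization.Instance R n) where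
  open RealField R
  open Maximization R
  open Semantics par I
  open State

  run : ∀ {k} → Command k → Vec (Fin n) k → State n → State n
  run skip                ρ σ = σ
  run (x ≔ e)             ρ σ = ⟨ reals σ [ x ↦ ⟦ e ⟧ ρ σ ] , sets σ ⟩
  run (insert i X)        ρ σ = ⟨ reals σ , sets σ [ X ↦ sets σ X ∪ ⁅ lookup ρ i ⁆ ] ⟩
  run (delete i X)        ρ σ = ⟨ reals σ , sets σ [ X ↦ sets σ X - lookup ρ i ] ⟩
  run (c ⨾ c′)            ρ σ = run c′ ρ (run c ρ σ)
  run (ifThenElse b c c′) ρ σ = if test b ρ σ then run c ρ σ else run c′ ρ σ
  -- An arbitrary value: `WhileFree` excludes this case wherever `run` is related to `Exec`.
  run (while b c)         ρ σ = σ
  run (forEach c)         ρ σ = foldl (λ τ u → run c (u Vec.∷ ρ) τ) σ (allFin n)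

  exec-run : ∀ {k} (c : Command k) → WhileFree c → ∀ ρ σ →
             ∃ λ t → Exec ρ c σ (run c ρ σ) t × t ℕ.≤ timeBound c n
  exec-run skip         _ ρ σ = 1 , skip , ℕ.≤-refl
  exec-run (x ≔ e)      _ ρ σ = _ , assign , ℕ.≤-refl
  exec-run (insert i X) _ ρ σ = 1 , insert , ℕ.≤-refl
  exec-run (delete i X) _ ρ σ = 1 , delete , ℕ.≤-refl
  exec-run (c ⨾ c′) (wf , wf′) ρ σ
    with t , e , t≤ ← exec-run c wf ρ σ
    with t′ , e′ , t′≤ ← exec-run c′ wf′ ρ (run c ρ σ) = t ℕ.+ t′ , seq e e′ , ℕ.+-mono-≤ t≤ t′≤
  exec-run (ifThenElse b c c′) (wf , wf′) ρ σ with test b ρ σ in eq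
  ... | true  with t , e , t≤ ← exec-run c wf ρ σ =
    _ , if-true eq e , ℕ.+-monoʳ-≤ (testTime b) (ℕ.≤-trans t≤ (ℕ.m≤m+n _ _))
  ... | false with t , e , t≤ ← exec-run c′ wf′ ρ σ =
    _ , if-false eq e , ℕ.+-monoʳ-≤ (testTime b) (ℕ.≤-trans t≤ (ℕ.m≤n+m _ _))
  exec-run (forEach c) wf ρ σ = let t , e , t≤ = each (allFin n) σ in
    suc t , for-each e , ℕ.s≤s (≡.subst (λ l → t ℕ.≤ l ℕ.* suc (timeBound c n)) (length-tabulate {n = n} id) t≤)
    where
    each : ∀ us σ → ∃ λ t → ExecEach ρ c us σ (foldl (λ τ u → run c (u Vec.∷ ρ) τ) σ us) t ×
                            t ℕ.≤ length us ℕ.* suc (timeBound c n)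
    each []       σ = 0 , [] , ℕ.z≤n
    each (u ∷ us) σ
      with t , e , t≤ ← exec-run c wf (u Vec.∷ ρ) σ
      with t′ , e′ , t′≤ ← each us (run c (u Vec.∷ ρ) σ) = _ , e ∷ e′ , ℕ.+-mono-≤ (ℕ.s≤s t≤) t′≤

  -- The invariant sees the elements still to come, so that at the end it can speak about all
  -- elements.
  forEach-invariant : ∀ {k} (P : List (Fin n) → State n → Set) {c : Command (suc k)} {ρ} →
    (∀ u us σ → P (u ∷ us) σ → P us (run c (u Vec.∷ ρ) σ)) →
    ∀ {σ} → P (allFin n) σ → P [] (run (forEach c) ρ σ)
  forEach-invariant P {c} {ρ} step = go (allFin n)
    where
    go : ∀ us {σ} → P us σ → P [] (foldl (λ τ u → run c (u Vec.∷ ρ) τ) σ us)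
    go []       h = h
    go (u ∷ us) h = go us (step u us _ h)

  if-does : ∀ {A : Set} (P : State n → Set) (a? : Dec A) {σ τ} → (A → P σ) → (¬ A → P τ) →
            P (if does a? then σ else τ)
  if-does P (yes a) yes-case _ = yes-case a
  if-does P (no ¬a) _ no-case  = no-case ¬a

  if-bool : ∀ (P : State n → Set) b {σ τ} → (b ≡ true → P σ) → (b ≡ false → P τ) →
            P (if b then σ else τ)
  if-bool P true  true-case _  = true-case ≡.refl
  if-bool P false _ false-case = false-case ≡.refl

-- Register assignment.  The current set and its cost; the largest value M of
-- f on ∅ and the singletons; |N| + 1; the current guess W for the optimum; the
-- saved value of f; and the amount by which the guess is lowered at the end of
-- the pass, which is zero as soon as the set has changed.

solution costReg maxReg sizeReg guessReg savedReg loweringReg : ℕ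
solution    = 0
costReg     = 0
maxReg      = 1
sizeReg     = 2
guessReg    = 3
savedReg    = 4
loweringReg = 5

fullTest : ∀ {k} → Test k
fullTest = (parameter logarithm ⊗ budgetB ⊑ literal 2 ⊗ real costReg) and neg (budgetB ⊑ literal 0)

removeTest : ∀ {k} → Test k
removeTest = parameter delta ⊗ real maxReg ⊑ real sizeReg ⊗ (value solution ⊖ real savedReg)

addTest : ∀ {k} → Test (suc k)
addTest = neg fullTest and ((real savedReg ⊑ value solution) and
  (costOf zero ⊗ (real guessReg ⊖ literal 2 ⊗ real savedReg) ⊑ budgetB ⊗ (value solution ⊖ real savedReg)))

-- The oracle reads only set registers, so a change is first carried out, then tested against the
-- saved value, and undone if rejected.
considerElement : ∀ {k} → Command (suc k)
considerElement = ifThenElse (zero ∈ˢ solution)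
  (savedReg ≔ value solution ⨾ delete zero solution ⨾
    ifThenElse removeTest
      (costReg ≔ real costReg ⊖ costOf zero ⨾ loweringReg ≔ literal 0)
      (insert zero solution))
  (savedReg ≔ value solution ⨾ insert zero solution ⨾
    ifThenElse addTest
      (costReg ≔ real costReg ⊕ costOf zero ⨾ loweringReg ≔ literal 0)
      (delete zero solution))

pass : ∀ {k} → Command k
pass = loweringReg ≔ parameter delta ⊗ real maxReg ⨾ forEach considerElement ⨾
       guessReg ≔ real guessReg ⊖ real loweringReg

setup : ∀ {k} → Command k
setup = sizeReg ≔ literal 1 ⨾ maxReg ≔ value solution ⨾
  forEach (insert zero solution ⨾
    ifThenElse (value solution ⊑ real maxReg) skip (maxReg ≔ value solution) ⨾
    delete zero solution ⨾ sizeReg ≔ literal 1 ⊕ real sizeReg) ⨾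
  guessReg ≔ real sizeReg ⊗ real maxReg

repeat : ℕ → ∀ {k} → Command k → Command k
repeat zero    c = skip
repeat (suc j) c = c ⨾ repeat j c

-- Each loop over the elements is followed by one more run of its body. This makes (n + 1)² passes,
-- and one even on the empty ground set.
squareManyPasses : ∀ {k} → Command k
squareManyPasses = forEach (forEach pass ⨾ pass) ⨾ forEach pass ⨾ pass

localSearch : ℕ → Program
localSearch K = setup ⨾ repeat K squareManyPasses

localSearch-whileFree : ∀ K → WhileFree (localSearch K)
localSearch-whileFree K = _ , repeat-whileFree K
  where
  repeat-whileFree : ∀ j → WhileFree (repeat j (squareManyPasses {0}))
  repeat-whileFree zero    = _
  repeat-whileFree (suc j) = _ , repeat-whileFree j

-- Correctness of the program

module LocalSearchCorrectness (R : RealField) (ε δ L : RealField.Carrier R) {n : ℕ}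
    (I : Maximization.Instance R n) where
  open RealField R
  open RealFieldProperties R
  open Maximization R
  open Instance I
  open Budget R L I
  open State
  open Running R (parameters ε δ L) I

  module Passes (M : Carrier) where
    open LocalSearch R δ L I M

    record Represents (σ : State n) (S : Subset n) (W d : Carrier) : Set where
      field
        set-≡      : sets σ solution ≡ S
        cost-≈     : reals σ costReg ≈ cost S
        max-≡      : reals σ maxReg ≡ M
        size-≈     : reals σ sizeReg ≈ m
        guess-≡    : reals σ guessReg ≡ W
        lowering-≡ : reals σ loweringReg ≡ d

    Initialised : Subset n → State n → Set
    Initialised O σ = (∃ λ W → ∃ λ d → Represents σ ⊥ W d × W ≈ m * M) ×
      f ⊥ ≤ M × M ≤ f O × (∀ u → f (⊥ [ u ]≔ true) ≤ M)

    considerElement-correct : ∀ {k} {ρ : Vec (Fin n) k} {σ S W d} u → Represents σ S W d →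
      let τ = run considerElement (u Vec.∷ ρ) σ in
      (Stuck S W u × Represents τ S W d) ⊎ (∃ λ S′ → Move S W S′ × Represents τ S′ W 0#)
    considerElement-correct {ρ = ρ} {σ} {S} {W} {d} u
      record { set-≡ = ≡.refl ; cost-≈ = cost-≈ ; max-≡ = max-≡ ; size-≈ = size-≈
             ; guess-≡ = ≡.refl ; lowering-≡ = ≡.refl } =
      if-bool Outcome (lookup S u)
        (λ S∋u → if-does Outcome
          (δ * reals σ maxReg ≤? reals σ sizeReg * (f (S - u) − f S))
          (λ accepted → inj₂ (_ , removal u S∋u (to-removable accepted) , record
            { set-≡ = -⁅⁆-≡ S u ; max-≡ = max-≡ ; size-≈ = size-≈ ; guess-≡ = ≡.refl ; lowering-≡ = ≡.refl
            ; cost-≈ = trans (+-congʳ (trans cost-≈ (weight-remove p S u S∋u)))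
                (solve 2 (λ a b → a :+ b :- b := a) refl _ _) }))
          (λ rejected → inj₁ (inj₁ (S∋u , rejected ∘ from-removable) , record
            { set-≡ = ≡.trans (≡.trans (≡.cong (_∪ ⁅ u ⁆) (-⁅⁆-≡ S u)) (∪⁅⁆-≡ _ u)) ([]≔-restore S u S∋u)
            ; cost-≈ = cost-≈ ; max-≡ = max-≡ ; size-≈ = size-≈ ; guess-≡ = ≡.refl ; lowering-≡ = ≡.refl })))
        (λ S∌u → if-does Outcome
          -- The `does` of this decision computes to the value of `addTest`, so either outcome of
          -- the test comes with a proof.
          (¬? ((L * B ≤? fromℕ 2 * reals σ costReg) ×-dec ¬? (B ≤? 0#)) ×-dec
            ((f S ≤? f (S ∪ ⁅ u ⁆)) ×-dec
              (p u * (W − fromℕ 2 * f S) ≤? B * (f (S ∪ ⁅ u ⁆) − f S))))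
          (λ { (¬full , dense) → inj₂ (_ , addition u S∌u (¬full ∘ from-full , to-dense dense) , record
            { set-≡ = ∪⁅⁆-≡ S u ; max-≡ = max-≡ ; size-≈ = size-≈ ; guess-≡ = ≡.refl ; lowering-≡ = ≡.refl
            ; cost-≈ = trans (+-congʳ cost-≈) (sym (weight-insert p S u S∌u)) }) })
          (λ rejected → inj₁ (inj₂ (S∌u ,
              λ { (¬full , dense) → rejected (¬full ∘ to-full , from-dense dense) }) , record
            { set-≡ = ≡.trans (≡.trans (≡.cong (_- u) (∪⁅⁆-≡ S u)) (-⁅⁆-≡ _ u)) ([]≔-restore S u S∌u)
            ; cost-≈ = cost-≈ ; max-≡ = max-≡ ; size-≈ = size-≈ ; guess-≡ = ≡.refl ; lowering-≡ = ≡.refl })))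
      where
      Outcome : State n → Set
      Outcome τ = (Stuck S W u × Represents τ S W d) ⊎ (∃ λ S′ → Move S W S′ × Represents τ S′ W 0#)

      Dense : Subset n → Set
      Dense S′ = f S ≤ f S′ × p u * (W − fromℕ 2 * f S) ≤ B * (f S′ − f S)

      to-dense : Dense (S ∪ ⁅ u ⁆) → Dense (S [ u ]≔ true)
      to-dense = ≡.subst Dense (∪⁅⁆-≡ S u)

      from-dense : Dense (S [ u ]≔ true) → Dense (S ∪ ⁅ u ⁆)
      from-dense = ≡.subst Dense (≡.sym (∪⁅⁆-≡ S u))

      gain-≈ : reals σ sizeReg * (f (S - u) − f S) ≈ m * (f (S [ u ]≔ false) − f S)
      gain-≈ = *-cong size-≈ (+-congʳ (reflexive (≡.cong f (-⁅⁆-≡ S u))))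

      max-≈ : δ * reals σ maxReg ≈ δ * M
      max-≈ = *-congˡ (reflexive max-≡)

      to-removable : δ * reals σ maxReg ≤ reals σ sizeReg * (f (S - u) − f S) → Removable S u
      to-removable le = ≤-respˡ-≈ max-≈ (≤-respʳ-≈ gain-≈ le)

      from-removable : Removable S u → δ * reals σ maxReg ≤ reals σ sizeReg * (f (S - u) − f S)
      from-removable le = ≤-respˡ-≈ (sym max-≈) (≤-respʳ-≈ (sym gain-≈) le)

      to-full : L * B ≤ fromℕ 2 * reals σ costReg × ¬ (B ≤ 0#) → IsFull S
      to-full (le , B≰0) = ≤-respʳ-≈ (*-congˡ cost-≈) le , B≰0

      from-full : IsFull S → L * B ≤ fromℕ 2 * reals σ costReg × ¬ (B ≤ 0#)
      from-full (le , B≰0) = ≤-respʳ-≈ (*-congˡ (sym cost-≈)) le , B≰0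

    module _ {β : Carrier} {O : Subset n} (assumptions : Assumptions ε β O) where
      open Assumptions assumptions
      open Analysis assumptions

      Reached : Carrier → State n → Set
      Reached t σ = ∃ λ S → ∃ λ W → ∃ λ d →
        Represents σ S W d × Invariant S W × Progress t S W

      weaken-reached : ∀ {t t′ σ} → t′ ≤ t → Reached t σ → Reached t′ σ
      weaken-reached t′≤t (S , W , d , rep , inv , progress) =
        S , W , d , rep , inv , weaken-progress t′≤t progress

      0≤δM : 0# ≤ δ * M
      0≤δM = 0≤δ ⊗⁰ 0≤M

      -- Either the set is untouched, so that every element visited is stuck and the lowering by δM
      -- is still due; or some move has already earned the pass its δM, and `W` will stay.
      DuringPass : Carrier → List (Fin n) → State n → Set
      DuringPass t us σ = ∃ λ S → ∃ λ W → ∃ λ d → Represents σ S W d × Invariant S W ×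
        ((d ≡ δ * M × (∀ u → u ∈ us ⊎ Stuck S W u) × Progress t S W)
         ⊎ (d ≡ 0# × Progress (t + δ * M) S W))

      considerElement-during : ∀ {k} {ρ : Vec (Fin n) k} {t} u us σ →
        DuringPass t (u ∷ us) σ → DuringPass t us (run considerElement (u Vec.∷ ρ) σ)
      considerElement-during {ρ = ρ} {t} u us σ (S , W , d , rep , inv , status)
        with considerElement-correct {ρ = ρ} u rep | status
      ... | inj₁ (stuck , rep′) | inj₁ (d≡δM , stuck-or-ahead , progress) =
        S , W , d , rep′ , inv , inj₁ (d≡δM , still-stuck , progress)
        where
        still-stuck : ∀ v → v ∈ us ⊎ Stuck S W v
        still-stuck v with stuck-or-ahead v
        ... | inj₁ (here ≡.refl)  = inj₂ stuck
        ... | inj₁ (there v∈us) = inj₁ v∈us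
        ... | inj₂ stuck′       = inj₂ stuck′
      ... | inj₁ (_ , rep′) | inj₂ moved = S , W , d , rep′ , inv , inj₂ moved
      ... | inj₂ (S′ , move , rep′) | inj₁ (_ , _ , progress) =
        S′ , W , 0# , rep′ , move-invariant move inv , inj₂ (≡.refl , move-progress move progress)
      ... | inj₂ (S′ , move , rep′) | inj₂ (_ , progress) =
        S′ , W , 0# , rep′ , move-invariant move inv , inj₂ (≡.refl ,
          -- Further moves raise the potential again, but a pass is credited with one unit only.
          weaken-progress (≤-by 0≤δM (solve 2 (λ x d → x :+ d :- x := d) refl _ _))
            (move-progress move progress))

      -- Progress is counted in units of δM, so that lower bounds on it compose along the program
      -- text.
      record Advances {k} (c : Command k) (x : Carrier) : Set where
        constructor advancing
        field
          advance : ∀ ρ t σ → Reached t σ → Reached (t + x * (δ * M)) (run c ρ σ)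

      open Advances

      pass-advances : ∀ {k} → Advances (pass {k}) 1#
      pass-advances {k} = advancing go
        where
        open Represents

        finish : ∀ {ρ : Vec (Fin n) k} {t τ} → DuringPass t [] τ →
          Reached (t + 1# * (δ * M)) (run (guessReg ≔ real guessReg ⊖ real loweringReg) ρ τ)
        finish {t = t} (S , W , d , rep , inv , status) = S , W − d , d , record
          { set-≡ = set-≡ rep ; cost-≈ = cost-≈ rep ; max-≡ = max-≡ rep ; size-≈ = size-≈ rep
          ; guess-≡ = ≡.cong₂ _−_ (guess-≡ rep) (lowering-≡ rep) ; lowering-≡ = lowering-≡ rep } ,
          outcome status
          where
          t-≤ : t + 1# * (δ * M) ≤ t + δ * M
          t-≤ = ≤-reflexive (+-congˡ (*-identityˡ _))
          outcome : (d ≡ δ * M × (∀ u → u ∈ [] ⊎ Stuck S W u) × Progress t S W)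
                    ⊎ (d ≡ 0# × Progress (t + δ * M) S W) →
                    Invariant S (W − d) × Progress (t + 1# * (δ * M)) S (W − d)
          outcome (inj₁ (≡.refl , stuck , progress)) = decrease-invariant 0≤δM inv ,
            weaken-progress t-≤ (stuck-progress inv all-stuck progress)
            where
            all-stuck : ∀ u → Stuck S W u
            all-stuck u with stuck u
            ... | inj₂ stuck-u = stuck-u
          outcome (inj₂ (≡.refl , progress)) = decrease-invariant ≤-refl inv ,
            weaken-progress t-≤ (progress-−0 progress)

        go : ∀ (ρ : Vec (Fin n) k) t σ → Reached t σ → Reached (t + 1# * (δ * M)) (run pass ρ σ)
        go ρ t σ (S , W , d , rep , inv , progress) = finish {ρ}
          (forEach-invariant (DuringPass t) {considerElement} {ρ} (considerElement-during {ρ = ρ}) start)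
          where
          start : DuringPass t (allFin n) (run (loweringReg ≔ parameter delta ⊗ real maxReg) ρ σ)
          start = S , W , _ , record
            { set-≡ = set-≡ rep ; cost-≈ = cost-≈ rep ; max-≡ = max-≡ rep ; size-≈ = size-≈ rep
            ; guess-≡ = guess-≡ rep ; lowering-≡ = ≡.refl } , inv ,
            inj₁ (≡.cong (δ *_) (max-≡ rep) , (λ u → inj₁ (∈-allFin u)) , progress)

      seq-advances : ∀ {k} {c c′ : Command k} {x y} → Advances c x → Advances c′ y → Advances (c ⨾ c′) (x + y)
      seq-advances c-adv c′-adv = advancing λ ρ t σ reached → weaken-reached
        (≤-reflexive (solve 4 (λ t x y d → t :+ (x :+ y) :* d := t :+ x :* d :+ y :* d) refl t _ _ _))
        (advance c′-adv ρ _ _ (advance c-adv ρ t σ reached))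

      forEach-advances : ∀ {k} {c : Command (suc k)} {x} → Advances c x → Advances (forEach c) (fromℕ n * x)
      forEach-advances {k} {c} {x} c-adv = advancing go
        where
        go : ∀ (ρ : Vec (Fin n) k) t σ → Reached t σ → Reached (t + fromℕ n * x * (δ * M)) (run (forEach c) ρ σ)
        go ρ t σ reached = weaken-reached
          (≤-reflexive (solve 2 (λ t y → t := t :- con (+ 0) :* y) refl _ (x * (δ * M))))
          -- The bound is stated as the target less the share of the elements still ahead.
          (forEach-invariant (λ us τ → Reached (target − fromℕ (length us) * (x * (δ * M))) τ) {c} {ρ}
            (λ u us τ reached′ → weaken-reached
              (≤-reflexive (solve 3 (λ t l y → t :- l :* y := t :- (con (+ 1) :+ l) :* y :+ y)
                refl target (fromℕ (length us)) _))
              (advance c-adv (u Vec.∷ ρ) _ τ reached′))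
            (weaken-reached (≤-reflexive start) reached))
          where
          target = t + fromℕ n * x * (δ * M)
          start : target − fromℕ (length (allFin n)) * (x * (δ * M)) ≈ t
          start rewrite length-tabulate {n = n} id =
            solve 4 (λ t n x d → t :+ n :* x :* d :- n :* (x :* d) := t) refl t (fromℕ n) x (δ * M)

      repeat-advances : ∀ {k} {c : Command k} {x} j → Advances c x → Advances (repeat j c) (fromℕ j * x)
      repeat-advances {x = x} zero c-adv = advancing λ ρ t σ reached → weaken-reached
        (≤-reflexive (solve 3 (λ t x d → t :+ con (+ 0) :* x :* d := t) refl t x (δ * M))) reached
      repeat-advances {x = x} (suc j) c-adv = advancing λ ρ t σ reached → weaken-reached
        (≤-reflexive (solve 4 (λ t j x d → t :+ (con (+ 1) :+ j) :* x :* d := t :+ (x :+ j :* x) :* d) refl t (fromℕ j) x (δ * M)))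
        (advance (seq-advances c-adv (repeat-advances j c-adv)) ρ t σ reached)

      search-advances : ∀ K → Advances {0} (repeat K squareManyPasses) (fromℕ K * (m * m))
      search-advances K = advancing λ ρ t σ reached → weaken-reached
        (≤-reflexive (solve 4 (λ t k n d →
            t :+ k :* ((con (+ 1) :+ n) :* (con (+ 1) :+ n)) :* d
            := t :+ k :* (n :* (n :* con (+ 1) :+ con (+ 1)) :+ (n :* con (+ 1) :+ con (+ 1))) :* d)
          refl t (fromℕ K) (fromℕ n) (δ * M)))
        (advance (repeat-advances K
          (seq-advances (forEach-advances (seq-advances (forEach-advances pass-advances) pass-advances))
            (seq-advances (forEach-advances pass-advances) pass-advances)))
          ρ t σ reached)

  SettingUp : Subset n → List (Fin n) → State n → Set
  SettingUp O us σ = sets σ solution ≡ ⊥ × reals σ costReg ≈ 0# ×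
    (reals σ sizeReg + fromℕ (length us) ≈ fromℕ (suc n)) ×
    f ⊥ ≤ reals σ maxReg × reals σ maxReg ≤ f O ×
    (∀ u → u ∈ us ⊎ f (⊥ [ u ]≔ true) ≤ reals σ maxReg)

  -- M ≤ f O holds because ∅ and, by `p≤B`, all singletons are feasible.
  setup-correct : ∀ O → IsOptimal O → ∃ λ M → Passes.Initialised M O (run setup Vec.[] initial)
  setup-correct O (O-feasible , O-maximal) =
    summarise (forEach-invariant (SettingUp O) {body} {Vec.[]} step start)
    where
    body : Command 1
    body = insert zero solution ⨾
      ifThenElse (value solution ⊑ real maxReg) skip (maxReg ≔ value solution) ⨾
      delete zero solution ⨾ sizeReg ≔ literal 1 ⊕ real sizeReg

    σ₀ : State n
    σ₀ = run (sizeReg ≔ literal 1 ⨾ maxReg ≔ value solution) Vec.[] initial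

    start : SettingUp O (allFin n) σ₀
    start = ≡.refl , refl , start-size , ≤-refl
      , O-maximal ⊥ (≤-trans (≤-reflexive (weight-⊥ p)) B-nonNegative)
      , λ u → inj₁ (∈-allFin u)
      where
      start-size : fromℕ 1 + fromℕ (length (allFin n)) ≈ fromℕ (suc n)
      start-size rewrite length-tabulate {n = n} id = +-congʳ (+-identityʳ 1#)

    singleton≤fO : ∀ u → f (⊥ [ u ]≔ true) ≤ f O
    singleton≤fO u = O-maximal _ (≤-trans (≤-reflexive
      (trans (weight-insert p ⊥ u (lookup-replicate u false))
        (trans (+-congʳ (weight-⊥ p)) (+-identityˡ _)))) (p≤B u))

    step : ∀ u us σ → SettingUp O (u ∷ us) σ → SettingUp O us (run body (u Vec.∷ Vec.[]) σ)
    step u us σ (set≡⊥ , cost≈0 , size≈ , f⊥≤ , ≤fO , singletons) =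
      if-does (λ τ → SettingUp O us (run (delete zero solution ⨾ sizeReg ≔ literal 1 ⊕ real sizeReg) (u Vec.∷ Vec.[]) τ))
        (f (sets σ solution ∪ ⁅ u ⁆) ≤? reals σ maxReg)
        (λ le → restored , cost≈0 , size≈′ , f⊥≤ , ≤fO , covered (≡.subst (_≤ reals σ maxReg) inserted le) singletons)
        (λ nle → restored , cost≈0 , size≈′ , ≤-trans f⊥≤ (≰⇒≥ nle)
          , ≡.subst (_≤ f O) (≡.sym inserted) (singleton≤fO u)
          , covered (≤-reflexive (reflexive (≡.sym inserted)))
              (λ v → map₂ (λ le → ≤-trans le (≰⇒≥ nle)) (singletons v)))
      where
      inserted : f (sets σ solution ∪ ⁅ u ⁆) ≡ f (⊥ [ u ]≔ true)
      inserted = ≡.cong f (≡.trans (≡.cong (_∪ ⁅ u ⁆) set≡⊥) (∪⁅⁆-≡ ⊥ u))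

      restored : sets σ solution ∪ ⁅ u ⁆ - u ≡ ⊥
      restored rewrite set≡⊥ | ∪⁅⁆-≡ ⊥ u | -⁅⁆-≡ (⊥ [ u ]≔ true) u =
        []≔-restore ⊥ u (lookup-replicate u false)

      size≈′ : fromℕ 1 + reals σ sizeReg + fromℕ (length us) ≈ fromℕ (suc n)
      size≈′ = trans (solve 2 (λ s l → (con (+ 1) :+ con (+ 0)) :+ s :+ l := s :+ (con (+ 1) :+ l)) refl _ _) size≈

      covered : ∀ {x} → f (⊥ [ u ]≔ true) ≤ x → (∀ v → v ∈ u ∷ us ⊎ f (⊥ [ v ]≔ true) ≤ x) →
                ∀ v → v ∈ us ⊎ f (⊥ [ v ]≔ true) ≤ x
      covered fu≤x h v with h v
      ... | inj₁ (here ≡.refl)  = inj₂ fu≤x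
      ... | inj₁ (there v∈us) = inj₁ v∈us
      ... | inj₂ fv≤x         = inj₂ fv≤x

    summarise : ∀ {σ} → SettingUp O [] σ →
      ∃ λ M → Passes.Initialised M O (run (guessReg ≔ real sizeReg ⊗ real maxReg) Vec.[] σ)
    summarise {σ} (set≡⊥ , cost≈0 , size≈ , f⊥≤ , ≤fO , singletons) = reals σ maxReg ,
      (_ , _ , record
        { set-≡ = set≡⊥ ; cost-≈ = trans cost≈0 (sym (weight-⊥ p)) ; max-≡ = ≡.refl
        ; size-≈ = size≈″ ; guess-≡ = ≡.refl ; lowering-≡ = ≡.refl } , *-congʳ size≈″) ,
      f⊥≤ , ≤fO , all-singletons
      where
      size≈″ : reals σ sizeReg ≈ fromℕ (suc n)
      size≈″ = trans (sym (+-identityʳ _)) size≈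
      all-singletons : ∀ u → f (⊥ [ u ]≔ true) ≤ reals σ maxReg
      all-singletons u with singletons u
      ... | inj₂ le = le

  optimum : ∃ IsOptimal
  optimum with subset-argmax f (λ S → cost S ≤? B)
  ... | inj₁ found = found
  ... | inj₂ none  = ⊥-elim (none ⊥ (≤-trans (≤-reflexive (weight-⊥ p)) B-nonNegative))

  localSearch-correct : ∀ {K β} → 0# ≤ δ → 0# < ε → IsLn (ε ⁻¹ * ½) L → 0# ≤ ½ − ε − δ →
    fromℕ 4 + fromℕ 3 * δ ≤ δ * fromℕ K → 0# ≤ β * B →
    AdditionsFit β →
    IsBicriteriaApproximation (½ − ε − δ) β (sets (run (localSearch K) Vec.[] initial) solution)
  localSearch-correct {K} {β} 0≤δ 0<ε isLn 0≤α K-large 0≤βB additions-fit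
    with O , (O-feasible , O-maximal) ← optimum
    with M , (W , d , rep , W≈mM) , f⊥≤M , M≤fO , singleton≤M ← setup-correct O (O-feasible , O-maximal) =
    conclude (advance (search-advances assumptions K) Vec.[] _ _
      (⊥ , W , d , rep , initial-invariant 0≤βB , initial-progress W≈mM))
    where
    open LocalSearch R δ L I M
    open Passes M
    assumptions : Assumptions ε β O
    assumptions = record
      { 0≤δ = 0≤δ ; 0<ε = 0<ε ; isLn = isLn ; 0≤α = 0≤α ; additions-fit = additions-fit
      ; O-feasible = O-feasible ; M≤fO = M≤fO ; f⊥≤M = f⊥≤M ; singleton≤M = singleton≤M }
    open Analysis assumptions
    open Advances
    conclude : ∀ {σ} → Reached assumptions (- (m * M) + fromℕ K * (m * m) * (δ * M)) σ →
      IsBicriteriaApproximation (½ − ε − δ) β (sets σ solution)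
    conclude (S , W , d , record { set-≡ = ≡.refl } , (fits , _) , progress) =
      -- `OPT` may differ from the optimum `O` of the analysis, but its value is no larger.
      (λ { OPT (OPT-feasible , _) → ≤-trans (*-monoʳ-≤ 0≤α (O-maximal OPT OPT-feasible))
             (progress⇒finished K-large progress) })
      , fits

-- Budgets

module Budgets (R : RealField) (L : RealField.Carrier R) where
  open RealField R
  open RealFieldProperties R
  open Maximization R

  double-half : ∀ x → x ≈ fromℕ 2 * ½ * x
  double-half x = sym (trans (*-congʳ ½-double) (*-identityˡ x))

  -1≤L⇒0≤1+½L : - 1# ≤ L → 0# ≤ 1# + ½ * L
  -1≤L⇒0≤1+½L -1≤L = *-cancel-≤ (fromℕ-suc-pos 1) (≤-by
    (≤⇒0≤− -1≤L ⊕⁰ 0≤1 ⊕⁰ ≈⇒0≤− (double-half L))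
    (solve 2 (λ h l → con (+ 2) :* (con (+ 1) :+ h :* l) :- con (+ 2) :* con (+ 0)
                      := (l :- (:- con (+ 1))) :+ con (+ 1) :+ (con (+ 2) :* h :* l :- l)) refl ½ L))

  -- ½ L ≥ - ½ rules out - 1 and everything below it as an upper bound.
  ceiling-natural : - 1# ≤ L → ∀ k → ½ * L ≤ fromℤ k → ∃ λ j → k ≡ + j
  ceiling-natural _ (+ j) _ = j , ≡.refl
  ceiling-natural -1≤L -[1+ j ] ½L≤k = ⊥-elim (1≰0 (≤-by
    (≤⇒0≤− -1≤L ⊕⁰ fromℕ-nonNeg 2 ⊗⁰ ≤⇒0≤− ½L≤k ⊕⁰ fromℕ-nonNeg 2 ⊗⁰ fromℕ-nonNeg j
      ⊕⁰ ≈⇒0≤− (double-half L))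
    (solve 3 (λ h l j → con (+ 0) :- con (+ 1)
        := (l :- (:- con (+ 1))) :+ con (+ 2) :* (:- (con (+ 1) :+ j) :- h :* l) :+ con (+ 2) :* j
           :+ (con (+ 2) :* h :* l :- l)) refl ½ L (fromℕ j))))

  module _ {n : ℕ} (I : Instance n) where
    open Instance I
    open Budget R L I

    -- A set that is not full costs at most ½ L B, and one more element at most B. If B = 0, the
    -- element is free and the set fits already.
    knapsack-additions-fit : AdditionsFit (1# + ½ * L)
    knapsack-additions-fit S u fits ¬full with B ≤? 0#
    ... | yes B≤0 = ≤-by (≤⇒0≤− fits ⊕⁰ ≤⇒0≤− (≤-trans (p≤B u) B≤0))
      (solve 3 (λ c p b → b :- (c :+ p) := b :- c :+ (con (+ 0) :- p)) refl _ _ _)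
    ... | no B≰0 = *-cancel-≤ (fromℕ-suc-pos 1) (≤-by
      (≤⇒0≤− (≰⇒≥ λ LB≤2c → ¬full (LB≤2c , B≰0)) ⊕⁰ fromℕ-nonNeg 2 ⊗⁰ ≤⇒0≤− (p≤B u)
        ⊕⁰ ≈⇒0≤− (double-half (L * B)))
      (solve 5 (λ h l b c p → con (+ 2) :* ((con (+ 1) :+ h :* l) :* b) :- con (+ 2) :* (c :+ p)
        := (l :* b :- con (+ 2) :* c) :+ con (+ 2) :* (b :- p) :+ (con (+ 2) :* h :* (l :* b) :- l :* b))
        refl ½ L B _ (p u)))

    -- Not being full gives cost S < ½ L B ≤ j b. The outer quantities are natural numbers, so the
    -- strict inequality leaves room for one more element; this saves the extra 1 of the knapsack
    -- ratio.
    cardinality-additions-fit : IsCardinalityConstraint → ∀ j → ½ * L ≤ fromℕ j → AdditionsFit (fromℕ j)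
    cardinality-additions-fit (p≈1 , b , B≈b) j ½L≤j S u _ ¬full with weight-natural p≈1 S
    ... | c , cost≈c = ≤-trans (≤-reflexive (trans (+-comm _ _) (+-cong (p≈1 u) cost≈c)))
      (≤-trans (fromℕ-mono 1+c≤jb) (≤-reflexive (trans (×1-homo-* j b) (*-congˡ (sym B≈b)))))
      where
      B≰0 : ¬ (B ≤ 0#)
      B≰0 B≤0 = 1≰0 (≤-trans (≤-reflexive (sym (p≈1 u))) (≤-trans (p≤B u) B≤0))
      1+c≤jb : suc c ℕ.≤ j ℕ.* b
      1+c≤jb = fromℕ-cancel-< λ jb≤c → ¬full ((≤-by
        (B-nonNegative ⊗⁰ (fromℕ-nonNeg 2 ⊗⁰ ≤⇒0≤− ½L≤j)
          ⊕⁰ fromℕ-nonNeg 2 ⊗⁰ ≤⇒0≤− (≤-trans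
              (≤-reflexive (trans (*-congˡ B≈b) (sym (×1-homo-* j b))))
              (≤-trans jb≤c (≤-reflexive (sym cost≈c))))
          ⊕⁰ ≈⇒0≤− (double-half (L * B)))
        (solve 5 (λ h l b c j → con (+ 2) :* c :- l :* b
          := b :* (con (+ 2) :* (j :- h :* l)) :+ con (+ 2) :* (c :- j :* b)
             :+ (con (+ 2) :* h :* (l :* b) :- l :* b)) refl ½ L B (cost S) (fromℕ j))) , B≰0)

theorem6p10 : (R : RealField) →
    let open RealField R
        open Maximization R
    in
    (δ : Carrier) → 0# < δ →
    Σ (ℕ → ℕ) λ T → IsPolynomiallyBounded T ×
      ((ε : Carrier) → 0# < ε → ε < 1# →
       (L : Carrier) → IsLn (ε ⁻¹ * ½) L →
       Σ Program λ A →
         IsBicriteriaAlgorithm (parameters ε δ L) A T (λ _ → ⊤)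
           (½ − ε − δ) (1# + ½ * L)
         ×
         ((k : ℤ) → IsCeiling (½ * L) k →
          IsBicriteriaAlgorithm (parameters ε δ L) A T Instance.IsCardinalityConstraint
            (½ − ε − δ) (fromℤ k)))
theorem6p10 R δ 0<δ = T , T-polynomial , algorithm
  where
  open RealField R
  open RealFieldProperties R
  open Maximization R

  K : ℕ
  -- (4 + 3δ) / δ rounded up, as `progress⇒finished` requires. It depends on δ alone, so one time
  -- bound serves every ε.
  K = proj₁ (archimedean ((fromℕ 4 + fromℕ 3 * δ) * δ ⁻¹))

  K-large : fromℕ 4 + fromℕ 3 * δ ≤ δ * fromℕ K
  K-large = ≤-trans (≤-reflexive (trans (sym (*-identityˡ _)) (trans (*-congʳ (sym (⁻¹-inverse 0<δ)))
      (solve 3 (λ d j x → d :* j :* x := d :* (x :* j)) refl δ (δ ⁻¹) _))))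
    (*-monoʳ-≤ (proj₁ 0<δ) (proj₂ (archimedean ((fromℕ 4 + fromℕ 3 * δ) * δ ⁻¹))))

  T : ℕ → ℕ
  -- The extra step covers `skip`, the program chosen when ½ - ε - δ is negative.
  T n = 1 ℕ.+ timeBound (localSearch K) n

  T-polynomial : IsPolynomiallyBounded T
  T-polynomial = polynomial-+ (polynomial-const 1) (timeBound-polynomial (localSearch K))

  module _ (ε : Carrier) (0<ε : 0# < ε) (ε<1 : ε < 1#) (L : Carrier) (isLn : IsLn (ε ⁻¹ * ½) L) where
    open Budgets R L

    -1≤L : - 1# ≤ L
    -1≤L = -1≤ln 0<ε ε<1 isLn

    Solves : Program → ∀ {n} → Instance n → Carrier → Set
    Solves A {n} I β = ∃ λ S → ∃ λ t → Semantics.Outputs (parameters ε δ L) I A S t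
      × t ℕ.≤ T n × Instance.IsBicriteriaApproximation I (½ − ε − δ) β S

    -- A negative ratio asks nothing of a nonnegative f, and ∅ costs nothing.
    skip-solves : ¬ (0# ≤ ½ − ε − δ) → ∀ {n} (I : Instance n) β → 0# ≤ β → Solves skip I β
    skip-solves 0≰α I β 0≤β = ⊥ , 1 , (_ , Semantics.skip , ≡.refl) , ℕ.s≤s ℕ.z≤n ,
      (λ OPT _ → ≤-trans (≤-by (≤⇒0≤− (≰⇒≥ 0≰α) ⊗⁰ f-nonNegative OPT)
          (solve 2 (λ a o → con (+ 0) :- a :* o := (con (+ 0) :- a) :* o) refl (½ − ε − δ) (f OPT)))
        (f-nonNegative ⊥)) ,
      ≤-trans (≤-reflexive (weight-⊥ p)) (0≤β ⊗⁰ B-nonNegative)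
      where open Instance I

    localSearch-solves : 0# ≤ ½ − ε − δ → ∀ {n} (I : Instance n) β → 0# ≤ β →
      Budget.AdditionsFit R L I β → Solves (localSearch K) I β
    localSearch-solves 0≤α I β 0≤β additions-fit
      with t , exec , t≤ ← Running.exec-run R (parameters ε δ L) I
                             (localSearch K) (localSearch-whileFree K) Vec.[] initial =
      _ , t , (_ , exec , ≡.refl) , ℕ.m≤n⇒m≤1+n t≤ ,
      LocalSearchCorrectness.localSearch-correct R ε δ L I {K}
        (proj₁ 0<δ) 0<ε isLn 0≤α K-large (0≤β ⊗⁰ Instance.B-nonNegative I) additions-fit

    -- The program is fixed before the instance and β, so the same one serves both kinds of
    -- constraint.
    solver : Σ Program λ A → ∀ {n} (I : Instance n) β → 0# ≤ β → Budget.AdditionsFit R L I β → Solves A I β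
    solver with 0# ≤? ½ − ε − δ
    ... | no 0≰α  = skip , λ I β 0≤β _ → skip-solves 0≰α I β 0≤β
    ... | yes 0≤α = localSearch K , localSearch-solves 0≤α

    algorithm : Σ Program λ A →
      IsBicriteriaAlgorithm (parameters ε δ L) A T (λ _ → ⊤) (½ − ε − δ) (1# + ½ * L) ×
      ((k : ℤ) → IsCeiling (½ * L) k →
        IsBicriteriaAlgorithm (parameters ε δ L) A T Instance.IsCardinalityConstraint (½ − ε − δ) (fromℤ k))
    algorithm = proj₁ solver
      , (λ I _ → proj₂ solver I _ (-1≤L⇒0≤1+½L -1≤L) (knapsack-additions-fit I))
      , λ k (_ , ½L≤k) I cardinality → cardinality-case k ½L≤k I cardinality
      where
      cardinality-case : ∀ k → ½ * L ≤ fromℤ k → ∀ {n} (I : Instance n) →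
        Instance.IsCardinalityConstraint I → Solves (proj₁ solver) I (fromℤ k)
      cardinality-case k ½L≤k I cardinality with j , ≡.refl ← ceiling-natural -1≤L k ½L≤k =
        proj₂ solver I (fromℕ j) (fromℕ-nonNeg j)
          (cardinality-additions-fit I cardinality j ½L≤k)
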